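{- Let $G$ be a finite simple graph and let $-G$ be the signed graph obtained by giving every edge of $G$ sign $-1$ (and adjoining a positive loop at every vertex). Then: (a) $\mathrm{BSTAB}(-G)=\mathrm{BIP}(G)$, where $\mathrm{BIP}(G)=\operatorname{conv}\{\mathbf 1_U: U\subseteq V(G),\ G[U]\text{ is bipartite}\}$; (b) $C(-G)=K_2\mathbin{\Box}G$, the Cartesian product of $K_2$ and $G$ (where $K_2$ has vertex set $\{\pm1\}$ and $(v,s)$ is identified with the pair $s\in V(K_2)$, $v\in V(G)$); (c) $\max\{\mathbf 1^{\mathsf T}x:x\in\mathrm{BTH}(-G)\}=\vartheta(K_2\mathbin{\Box}G)$, where $\vartheta$ is the Lovász theta number; (d) $\mathrm{BQSTAB}(-G)=\{x\in[0,1]^{V(G)}:x(K)\le2\text{ for every clique }K\text{ of }G\}$, where $x(K)=\sum_{v\in K}x_v$.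
   Context: Signed graphs. A signed graph is a pair $\Sigma=(G,\sigma)$ with $G$ a finite graph and $\sigma:E(G)\to\{+1,-1\}$. Positive loops are allowed, negative loops are excluded. A signed graph is balanced if every cycle has positive sign (product of edge signs); a set $B\subseteq V(\Sigma)$ is balanced if the induced signed graph $\Sigma[B]$ is balanced. Conflict graph. For a signed graph $\Sigma$ with a positive loop at every vertex, $C(\Sigma)$ is the ordinary simple graph on $V(\Sigma)\times\{\pm1\}$ with $(u,s)\sim(v,r)$ iff there is an edge $e=uv$ of $\Sigma$ (possibly a loop, $u=v$) with $r=-\sigma(e)s$. In particular $(v,+)\sim(v,-)$ for all $v$. Ordinary bodies. For a finite simple graph $H$: $\mathrm{QSTAB}(H)=\{x\ge0: x(K)\le1\text{ for every clique }K\}$; $\mathrm{TH}(H)=\{x:\exists\, X\text{ symmetric with }\begin{pmatrix} 1 & x^{\mathsf T} \\ x & X \end{pmatrix}\succeq0,\ \operatorname{diag}X=x,\ X_{uv}=0\ (uv\in E(H))\}$. Signed bodies. Let $p:\mathbb R^{V(\Sigma)\times\{\pm1\}}\to\mathbb R^{V(\Sigma)}$, $p(y)_v=y_{(v,+)}+y_{(v,-)}$. Then $\mathrm{BSTAB}(\Sigma)=\operatorname{conv}\{\mathbf 1_B:B\subseteq V(\Sigma)\text{ balanced}\}$, $\mathrm{BTH}(\Sigma)=p(\mathrm{TH}(C(\Sigma)))$, and $\mathrm{BQSTAB}(\Sigma)=p(\mathrm{QSTAB}(C(\Sigma)))$. Lovász theta number of a nonempty graph $H$: $\vartheta(H)=\max\{\langle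 J,Z\rangle: Z\succeq0,\ \operatorname{Tr}Z=1,\ Z_{uv}=0\ (uv\in E(H))\}$, with $J$ the all-ones matrix. -}

module Defs where

open import Level using (0ℓ)
open import Algebra.Bundles using (CommutativeRing)
import Algebra.Properties.Monoid.Sum as MonoidSum
open import Data.Bool.Base using (Bool; T; if_then_else_)
open import Data.Empty using (⊥-elim)
open import Data.Fin.Base using (Fin)
open import Data.Fin.Properties using (1↔⊤; *↔×; +↔⊎) renaming (_≟_ to _≟ᶠ_)
open import Data.List.Base using (List; []; _∷_; length)
open import Data.List.Relation.Unary.Unique.Propositional using (Unique)
open import Data.Nat.Base using (ℕ)
import Data.Nat.Base as ℕ
open import Data.Product.Base using (Σ-syntax; ∃; ∃-syntax; _×_; _,_; proj₁; proj₂)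
open import Data.Product.Function.NonDependent.Propositional using (_×-↔_)
open import Data.Sign.Base using (Sign; opposite) renaming (_*_ to _*ˢ_)
import Data.Sign.Base as Sign
import Data.Sign.Properties as Sign
open import Data.Sum.Base using (_⊎_; inj₁; inj₂)
open import Data.Sum.Function.Propositional using (_⊎-↔_)
open import Data.Unit.Base using (⊤)
open import Function.Base using (_∘_)
open import Function.Bundles using (_↔_; Inverse; mk↔ₛ′)
open import Function.Construct.Composition using (_↔-∘_)
open import Function.Construct.Symmetry using (↔-sym)
open import Relation.Binary.Core using (Rel)
open import Relation.Binary.Definitions using (Decidable; DecidableEquality; Symmetric; Irreflexive)
open import Relation.Binary.Structures using (IsDecTotalOrder)
open import Relation.Binary.PropositionalEquality
  using (_≡_; _≢_; refl; sym; trans; cong; ≢-sym)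
open import Relation.Nullary.Decidable using (yes; no; map′; _×-dec_; _⊎-dec_; ¬?)
open import Relation.Nullary.Negation using (¬_)
open import Relation.Unary using (Pred)

------------------------------------------------------------------------
-- The real numbers

-- The real numbers enter through their axioms, which determine them up to
-- isomorphism.  Decidability of the order expresses trichotomy.

record CompleteOrderedField : Set₁ where
  field
    commutativeRing : CommutativeRing 0ℓ 0ℓ
  open CommutativeRing commutativeRing public
    using (Carrier; _≈_; _+_; _*_; -_; 0#; 1#; +-monoid)
  field
    0≉1             : ¬ (0# ≈ 1#)
    inverse         : ∀ x → ¬ (x ≈ 0#) → ∃[ y ] x * y ≈ 1#
    _≤_             : Rel Carrier 0ℓ
    isDecTotalOrder : IsDecTotalOrder _≈_ _≤_
    +-monoʳ-≤       : ∀ x {y z} → y ≤ z → (x + y) ≤ (x + z)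
    *-nonneg        : ∀ {x y} → 0# ≤ x → 0# ≤ y → 0# ≤ (x * y)

  infix 4 _≤_

  _isUpperBoundOf_ : Carrier → Pred Carrier 0ℓ → Set
  b isUpperBoundOf P = ∀ {x} → P x → x ≤ b

  field
    supremum : (P : Pred Carrier 0ℓ) → ∃ P → ∃ (_isUpperBoundOf P) →
               ∃[ s ] s isUpperBoundOf P × (∀ b → b isUpperBoundOf P → s ≤ b)

------------------------------------------------------------------------
-- Finite types

record Finite (V : Set) : Set where
  field
    size : ℕ
    enum : V ↔ Fin size

  element : Fin size → V
  element = Inverse.from enum

  _≟_ : DecidableEquality V
  u ≟ v = map′
    (λ eq → trans (sym (Inverse.strictlyInverseʳ enum u))
                  (trans (cong element eq) (Inverse.strictlyInverseʳ enum v)))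
    (cong (Inverse.to enum))
    (Inverse.to enum u ≟ᶠ Inverse.to enum v)

open Finite {{...}} using (element; _≟_)

instance
  ⊤-finite : Finite ⊤
  ⊤-finite = record { size = 1 ; enum = ↔-sym 1↔⊤ }

  Sign-finite : Finite Sign
  Sign-finite = record
    { size = 2
    ; enum = mk↔ₛ′
        (λ { Sign.+ → Fin.zero ; Sign.- → Fin.suc Fin.zero })
        (λ { Fin.zero → Sign.+ ; (Fin.suc Fin.zero) → Sign.- })
        (λ { Fin.zero → refl ; (Fin.suc Fin.zero) → refl })
        (λ { Sign.+ → refl ; Sign.- → refl })
    }

  ×-finite : ∀ {V W : Set} → {{Finite V}} → {{Finite W}} → Finite (V × W)
  ×-finite {{v}} {{w}} = record
    { size = Finite.size v ℕ.* Finite.size w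
    ; enum = ↔-sym *↔× ↔-∘ (Finite.enum v ×-↔ Finite.enum w)
    }

  ⊎-finite : ∀ {V W : Set} → {{Finite V}} → {{Finite W}} → Finite (V ⊎ W)
  ⊎-finite {{v}} {{w}} = record
    { size = Finite.size v ℕ.+ Finite.size w
    ; enum = ↔-sym +↔⊎ ↔-∘ (Finite.enum v ⊎-↔ Finite.enum w)
    }

Subset : Set → Set
Subset V = V → Bool

infix 4 _∈_
_∈_ : ∀ {V : Set} → V → Subset V → Set
v ∈ B = T (B v)

⟪_⟫ : ∀ {V : Set} → Subset V → Set
⟪_⟫ {V} B = Σ[ v ∈ V ] v ∈ B

------------------------------------------------------------------------
-- Simple graphs

record SimpleGraph (V : Set) : Set₁ where
  field
    Adj     : Rel V 0ℓ
    adj?    : Decidable Adj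
    adj-sym : Symmetric Adj
    irrefl  : Irreflexive _≡_ Adj

open SimpleGraph

infix 30 _[_] _[_]ˢ

_[_] : ∀ {V} → SimpleGraph V → (U : Subset V) → SimpleGraph ⟪ U ⟫
(G [ U ]) .Adj u v      = Adj G (proj₁ u) (proj₁ v)
(G [ U ]) .adj? u v     = adj? G (proj₁ u) (proj₁ v)
(G [ U ]) .adj-sym      = adj-sym G
(G [ U ]) .irrefl refl  = irrefl G refl

Bipartite : ∀ {V} → SimpleGraph V → Set
Bipartite {V} G = Σ[ c ∈ (V → Bool) ] (∀ {u v} → Adj G u v → c u ≢ c v)

IsClique : ∀ {V} → SimpleGraph V → Subset V → Set
IsClique G K = ∀ {u v} → u ∈ K → v ∈ K → u ≢ v → Adj G u v

complete : (V : Set) → {{Finite V}} → SimpleGraph V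
complete V .Adj u v          = u ≢ v
complete V .adj? u v         = ¬? (u ≟ v)
complete V .adj-sym          = ≢-sym
complete V .irrefl refl u≢u  = u≢u refl

K₂ : SimpleGraph Sign
K₂ = complete Sign

infixr 20 _□_

_□_ : ∀ {V W} → {{Finite V}} → {{Finite W}} →
      SimpleGraph V → SimpleGraph W → SimpleGraph (V × W)
(G □ H) .Adj (u , a) (v , b) = (u ≡ v × Adj H a b) ⊎ (Adj G u v × a ≡ b)
(G □ H) .adj? (u , a) (v , b) =
  ((u ≟ v) ×-dec adj? H a b) ⊎-dec (adj? G u v ×-dec (a ≟ b))
(G □ H) .adj-sym (inj₁ (eq , e)) = inj₁ (sym eq , adj-sym H e)
(G □ H) .adj-sym (inj₂ (e , eq)) = inj₂ (adj-sym G e , sym eq)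
(G □ H) .irrefl refl (inj₁ (_ , e)) = irrefl H refl e
(G □ H) .irrefl refl (inj₂ (e , _)) = irrefl G refl e

------------------------------------------------------------------------
-- Signed graphs

-- σ-sym also makes σ independent of the adjacency proof (apply it twice), so
-- σ is a function on the unordered edges.
record SignedGraph (V : Set) : Set₁ where
  field
    Edge            : Rel V 0ℓ
    edge?           : Decidable Edge
    edge-sym        : Symmetric Edge
    σ               : ∀ {u v} → Edge u v → Sign
    σ-sym           : ∀ {u v} (e : Edge u v) (e′ : Edge v u) → σ e ≡ σ e′
    noNegativeLoops : ∀ {v} (e : Edge v v) → σ e ≡ Sign.+

_[_]ˢ : ∀ {V} → SignedGraph V → (B : Subset V) → SignedGraph ⟪ B ⟫
Γ [ B ]ˢ = record
  { Edge            = λ u v → Edge (proj₁ u) (proj₁ v)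
  ; edge?           = λ u v → edge? (proj₁ u) (proj₁ v)
  ; edge-sym        = edge-sym
  ; σ               = σ
  ; σ-sym           = σ-sym
  ; noNegativeLoops = noNegativeLoops
  }
  where open SignedGraph Γ

module _ {V : Set} (Γ : SignedGraph V) where
  open SignedGraph Γ

  data Walk : V → V → Set where
    []  : ∀ {v} → Walk v v
    _∷_ : ∀ {u v w} → Edge u v → Walk v w → Walk u w

  -- The end vertex is left out, so a closed walk lists its base point once.
  vertices : ∀ {u v} → Walk u v → List V
  vertices []            = []
  vertices (_∷_ {u} e w) = u ∷ vertices w

  walkSign : ∀ {u v} → Walk u v → Sign
  walkSign []      = Sign.+
  walkSign (e ∷ w) = σ e *ˢ walkSign w

  -- Length 1 is a loop.  There are no parallel edges, so a closed walk of
  -- length 2 through distinct vertices runs back along its first edge.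
  IsCycle : ∀ {v} → Walk v v → Set
  IsCycle w = Unique (vertices w) × length (vertices w) ≢ 0 × length (vertices w) ≢ 2

  Balanced : Set
  Balanced = ∀ {v} (w : Walk v v) → IsCycle w → walkSign w ≡ Sign.+

BalancedSet : ∀ {V} → SignedGraph V → Subset V → Set
BalancedSet Γ B = Balanced (Γ [ B ]ˢ)

-- −G, including the positive loop at every vertex.
neg : ∀ {V} → {{Finite V}} → SimpleGraph V → SignedGraph V
neg {V} G = record
  { Edge            = NegEdge
  ; edge?           = λ u v → (u ≟ v) ⊎-dec adj? G u v
  ; edge-sym        = λ { (inj₁ eq) → inj₁ (sym eq) ; (inj₂ e) → inj₂ (adj-sym G e) }
  ; σ               = sign
  ; σ-sym           = sign-sym
  ; noNegativeLoops = λ { (inj₁ _) → refl ; (inj₂ e) → ⊥-elim (irrefl G refl e) }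
  }
  where
  NegEdge : Rel V 0ℓ
  NegEdge u v = u ≡ v ⊎ Adj G u v

  sign : ∀ {u v} → NegEdge u v → Sign
  sign (inj₁ _) = Sign.+
  sign (inj₂ _) = Sign.-

  sign-sym : ∀ {u v} (e : NegEdge u v) (e′ : NegEdge v u) → sign e ≡ sign e′
  sign-sym (inj₁ _)    (inj₁ _)    = refl
  sign-sym (inj₁ refl) (inj₂ e)    = ⊥-elim (irrefl G refl e)
  sign-sym (inj₂ e)    (inj₁ refl) = ⊥-elim (irrefl G refl e)
  sign-sym (inj₂ _)    (inj₂ _)    = refl

conflictGraph : ∀ {V} → SignedGraph V → SimpleGraph (V × Sign)
conflictGraph {V} Γ = record
  { Adj     = Conflict
  ; adj?    = dec
  ; adj-sym = λ { {u , s} {v , r} (e , refl) →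
      edge-sym e , trans (flip (σ e) s)
        (cong (λ a → opposite (a *ˢ opposite (σ e *ˢ s))) (σ-sym e (edge-sym e))) }
  ; irrefl  = λ { {v , s} refl (e , eq) →
      noFix s (trans eq (cong (λ a → opposite (a *ˢ s)) (noNegativeLoops e))) }
  }
  where
  open SignedGraph Γ

  Conflict : Rel (V × Sign) 0ℓ
  Conflict (u , s) (v , r) = Σ[ e ∈ Edge u v ] r ≡ opposite (σ e *ˢ s)

  flip : ∀ a s → s ≡ opposite (a *ˢ opposite (a *ˢ s))
  flip Sign.+ Sign.+ = refl
  flip Sign.+ Sign.- = refl
  flip Sign.- Sign.+ = refl
  flip Sign.- Sign.- = refl

  noFix : ∀ s → s ≢ opposite s
  noFix Sign.+ ()
  noFix Sign.- ()

  σ-irr : ∀ {u v} (e e′ : Edge u v) → σ e ≡ σ e′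
  σ-irr e e′ = trans (σ-sym e (edge-sym e)) (sym (σ-sym e′ (edge-sym e)))

  dec : Decidable Conflict
  dec (u , s) (v , r) with edge? u v
  ... | no ¬e = no (¬e ∘ proj₁)
  ... | yes e = map′ (e ,_)
    (λ { (e′ , eq) → trans eq (cong (λ a → opposite (a *ˢ s)) (σ-irr e′ e)) })
    (r Sign.≟ opposite (σ e *ˢ s))

------------------------------------------------------------------------
-- Convex bodies

module _ (ℝ : CompleteOrderedField) where
  open CompleteOrderedField ℝ
  open MonoidSum +-monoid using (sum)

  Vector : Set → Set
  Vector V = V → Carrier

  Matrix : Set → Set
  Matrix V = V → V → Carrier

  infix 4 _≈ᵛ_
  _≈ᵛ_ : ∀ {V} → Vector V → Vector V → Set
  x ≈ᵛ y = ∀ v → x v ≈ y v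

  ∑ : ∀ {V} → {{Finite V}} → Vector V → Carrier
  ∑ x = sum (λ i → x (element i))

  ∑[_] : ∀ {V} → {{Finite V}} → Subset V → Vector V → Carrier
  ∑[ K ] x = ∑ (λ v → if K v then x v else 0#)

  𝟏[_] : ∀ {V} → Subset V → Vector V
  𝟏[ B ] v = if B v then 1# else 0#

  IsSymmetric : ∀ {V} → Matrix V → Set
  IsSymmetric X = ∀ u v → X u v ≈ X v u

  PSD : ∀ {V} → {{Finite V}} → Matrix V → Set
  PSD {V} X = IsSymmetric X ×
    ((z : Vector V) → 0# ≤ ∑ (λ u → ∑ (λ v → z u * X u v * z v)))

  tr : ∀ {V} → {{Finite V}} → Matrix V → Carrier
  tr X = ∑ (λ v → X v v)

  ⟨_,_⟩ : ∀ {V} → {{Finite V}} → Matrix V → Matrix V → Carrier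
  ⟨ X , Y ⟩ = ∑ (λ u → ∑ (λ v → X u v * Y u v))

  J : ∀ {V} → Matrix V
  J _ _ = 1#

  bordered : ∀ {V} → Vector V → Matrix V → Matrix (⊤ ⊎ V)
  bordered x X (inj₁ _) (inj₁ _) = 1#
  bordered x X (inj₁ _) (inj₂ v) = x v
  bordered x X (inj₂ u) (inj₁ _) = x u
  bordered x X (inj₂ u) (inj₂ v) = X u v

  IsConvexCombination : ∀ {V k} → Vector (Fin k) → (Fin k → Vector V) → Vector V → Set
  IsConvexCombination λs ps x =
    (∀ i → 0# ≤ λs i) × sum λs ≈ 1# × x ≈ᵛ (λ v → sum (λ i → λs i * ps i v))

  conv : ∀ {V} → Pred (Vector V) 0ℓ → Pred (Vector V) 0ℓ
  conv {V} S x = Σ[ k ∈ ℕ ] Σ[ λs ∈ Vector (Fin k) ] Σ[ ps ∈ (Fin k → Vector V) ]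
    (∀ i → S (ps i)) × IsConvexCombination λs ps x

  IsMaximum : {A : Set} → (A → Carrier) → Pred A 0ℓ → Carrier → Set
  IsMaximum f S m = (∃[ x ] S x × f x ≈ m) × (∀ x → S x → f x ≤ m)

  QSTAB : ∀ {V} → {{Finite V}} → SimpleGraph V → Pred (Vector V) 0ℓ
  QSTAB H x = (∀ v → 0# ≤ x v) × (∀ K → IsClique H K → ∑[ K ] x ≤ 1#)

  TH : ∀ {V} → {{Finite V}} → SimpleGraph V → Pred (Vector V) 0ℓ
  TH {V} H x = Σ[ X ∈ Matrix V ]
    IsSymmetric X × PSD (bordered x X) ×
    (∀ v → X v v ≈ x v) × (∀ {u v} → Adj H u v → X u v ≈ 0#)

  ThetaFeasible : ∀ {V} → {{Finite V}} → SimpleGraph V → Pred (Matrix V) 0ℓ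
  ThetaFeasible H Z = PSD Z × tr Z ≈ 1# × (∀ {u v} → Adj H u v → Z u v ≈ 0#)

  -- The Lovász theta number as a relation: ϑ H t says that the maximum is
  -- attained and equals t.
  ϑ : ∀ {V} → {{Finite V}} → SimpleGraph V → Carrier → Set
  ϑ H = IsMaximum (λ Z → ⟨ J , Z ⟩) (ThetaFeasible H)

  p : ∀ {V} → Vector (V × Sign) → Vector V
  p y v = y (v , Sign.+) + y (v , Sign.-)

  p-image : ∀ {V} → Pred (Vector (V × Sign)) 0ℓ → Pred (Vector V) 0ℓ
  p-image S x = ∃[ y ] S y × x ≈ᵛ p y

  BSTAB : ∀ {V} → SignedGraph V → Pred (Vector V) 0ℓ
  BSTAB Γ = conv (λ x → ∃[ B ] BalancedSet Γ B × x ≈ᵛ 𝟏[ B ])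

  BTH : ∀ {V} → {{Finite V}} → SignedGraph V → Pred (Vector V) 0ℓ
  BTH Γ = p-image (TH (conflictGraph Γ))

  BQSTAB : ∀ {V} → {{Finite V}} → SignedGraph V → Pred (Vector V) 0ℓ
  BQSTAB Γ = p-image (QSTAB (conflictGraph Γ))

  BIP : ∀ {V} → SimpleGraph V → Pred (Vector V) 0ℓ
  BIP G = conv (λ x → ∃[ U ] Bipartite (G [ U ]) × x ≈ᵛ 𝟏[ U ])

  CliqueBody : ∀ {V} → {{Finite V}} → SimpleGraph V → Pred (Vector V) 0ℓ
  CliqueBody G x = (∀ v → 0# ≤ x v × x v ≤ 1#) ×
    (∀ K → IsClique G K → ∑[ K ] x ≤ 1# + 1#)

-- (c) The semidefinite programs TH and ϑ are related by explicit transformations.  From (x, X) in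
-- TH(H) with s = Σx > 0 the matrix X / s is feasible for ϑ, with value at least s.  From Z feasible
-- with value t > 0, the row sums w of Z give D with D_u Z_uu = w_u, and X = D Z D / t lies in TH(H)
-- with Σ diag X ≥ t.  So both maxima agree as soon as one is attained.  That holds by compactness of
-- the feasible set: a maximiser is built coordinate by coordinate as an iterated upper limit of
-- nearly optimal points.  Its existence needs no choice, and since the order is decidable the
-- conditions it satisfies may be checked on ¬¬-existing approximants.
--
-- (a) is Harary's theorem: a balanced signed graph has a switching function, which for −G[U] is a
-- proper 2-colouring.  (d) A clique of K₂ □ G lies in one layer or in one fibre, so y(v, ±) = x_v / 2
-- is a preimage of x.

module Submission where

open import Defs
open import Data.Product.Base using (_×_; ∃-syntax; swap)
open import Function.Bundles using (_⇔_)
open import Relation.Unary using (_≐_)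

open import Level using (0ℓ)
open import Algebra.Bundles using (CommutativeRing)
import Algebra.Properties.Ring as RingProperties
import Algebra.Properties.Semiring.Mult.TCOptimised as SemiringMult
import Algebra.Properties.Semiring.Sum as SemiringSum
import Algebra.Solver.Ring as RingSolver
open import Algebra.Solver.Ring.AlmostCommutativeRing using (_-Raw-AlmostCommutative⟶_; fromCommutativeRing)
open import Data.Bool.Base using (Bool; true; false; T; if_then_else_; _∧_)
open import Data.Bool.Properties using (T?; T-irrelevant)
open import Data.Empty using (⊥; ⊥-elim)
open import Data.Fin.Base as Fin using (Fin; zero; suc; punchIn; splitAt; remQuot)
open import Data.Fin.Properties as Fin using (punchInᵢ≢i)
open import Data.Integer.Base as ℤ using (ℤ; +_; -[1+_]; _⊖_)
import Data.Integer.Properties as ℤ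
open import Data.List.Base using (List; []; _∷_; length; cartesianProduct; tabulate)
open import Data.List.Membership.Propositional using () renaming (_∈_ to _∈ₗ_)
open import Data.List.Membership.Propositional.Properties using (∈-cartesianProduct⁺; ∈-tabulate⁺)
open import Data.List.Relation.Unary.All.Properties using (¬Any⇒All¬)
import Data.List.Relation.Unary.AllPairs.Core as AllPairs
open import Data.List.Relation.Unary.Any using (here; there; any?)
open import Data.List.Relation.Unary.Unique.Propositional using (Unique)
open import Data.Maybe.Base as Maybe using (Maybe)
open import Data.Nat.Base as ℕ using (ℕ; zero; suc)
import Data.Nat.Properties as ℕ
open import Data.Product.Base as Product using (Σ-syntax; _,_; proj₁; proj₂)
open import Data.Sign.Base as Sign using (Sign; opposite) renaming (_*_ to _*ˢ_)
import Data.Sign.Properties as Sign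
open import Data.Sum.Base using (_⊎_; inj₁; inj₂; [_,_]′; map₁)
open import Data.Unit.Base using (⊤; tt)
open import Function.Base using (_∘_)
open import Function.Bundles using (_↔_; Inverse; Equivalence; mk⇔)
open import Function.Construct.Composition using (_↔-∘_)
open import Function.Construct.Symmetry using (↔-sym)
open import Function.Related.TypeIsomorphisms using (×-comm)
open import Relation.Binary.Bundles using (Poset)
open import Relation.Binary.Consequences using (dec⇒weaklyDec)
open import Relation.Binary.Definitions using (DecidableEquality)
open import Relation.Binary.PropositionalEquality as ≡ using (_≡_; _≢_)
open import Relation.Binary.Structures using (IsDecTotalOrder)
open import Relation.Nullary.Decidable using (Dec; yes; no; does; decidable-stable; dec-true; dec-false; map′)
open import Relation.Nullary.Negation using (¬_)

-- Balance speaks of cycles only, while a switching function needs every closed walk to be positive;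
-- cutting closed pieces out of a walk bridges the gap. Connected components are never computed:
-- classes are grown while all pairs of vertices are scanned. In (c) compactness is applied to the
-- trace-one program, because its trace condition confines all entries to [-1, 1] and, for each
-- fixed test vector, its conditions are linear in the matrix. A single diagonal entry 1 is feasible
-- with value 1, so the optimum is positive and may be divided by; a vertex is required for this.
-- The scaling D is forced by diag X = x: with border D w / t the diagonal of D Z D / t must equal
-- it, that is, D_u Z_uu = w_u. This is solvable even when Z_uu = 0, since semidefiniteness then
-- makes the row sum zero. The projection `p` preserves the total of the coordinates, so a maximum
-- over TH of the conflict graph is one over BTH. In (d) the factor 1/2 turns the bound 2 on a
-- clique into the bound 1 on a layer, while on a fibre the two halves add up to x_v ≤ 1.

-- Harary's theorem: closed walks and switching functions.

module Walks {V : Set} (Γ : SignedGraph V) where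
  open SignedGraph Γ
  open ≡.≡-Reasoning

  _++ʷ_ : ∀ {u v w} → Walk Γ u v → Walk Γ v w → Walk Γ u w
  []      ++ʷ q = q
  (e ∷ p) ++ʷ q = e ∷ (p ++ʷ q)

  sign-++ : ∀ {u v w} (p : Walk Γ u v) (q : Walk Γ v w) →
            walkSign Γ (p ++ʷ q) ≡ walkSign Γ p *ˢ walkSign Γ q
  sign-++ []      q = ≡.refl
  sign-++ (e ∷ p) q = ≡.trans (≡.cong (σ e *ˢ_) (sign-++ p q)) (≡.sym (Sign.*-assoc (σ e) _ _))

  reverseʷ : ∀ {u v} → Walk Γ u v → Walk Γ v u
  reverseʷ []      = []
  reverseʷ (e ∷ p) = reverseʷ p ++ʷ (edge-sym e ∷ [])

  sign-reverse : ∀ {u v} (p : Walk Γ u v) → walkSign Γ (reverseʷ p) ≡ walkSign Γ p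
  sign-reverse []      = ≡.refl
  sign-reverse (e ∷ p) = begin
    walkSign Γ (reverseʷ p ++ʷ (edge-sym e ∷ []))         ≡⟨ sign-++ (reverseʷ p) (edge-sym e ∷ []) ⟩
    walkSign Γ (reverseʷ p) *ˢ (σ (edge-sym e) *ˢ Sign.+) ≡⟨ ≡.cong₂ _*ˢ_ (sign-reverse p) (≡.trans (Sign.*-identityʳ _) (σ-sym (edge-sym e) e)) ⟩
    walkSign Γ p *ˢ σ e                                   ≡⟨ Sign.*-comm _ (σ e) ⟩
    σ e *ˢ walkSign Γ p                                   ∎

  σ-irrelevant : ∀ {u v} (e e′ : Edge u v) → σ e ≡ σ e′
  σ-irrelevant e e′ = ≡.trans (σ-sym e (edge-sym e)) (σ-sym (edge-sym e) e′)

  -- A multiplicative potential: the sign of each edge is the quotient of the values at its ends.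
  IsSwitching : (V → Sign) → Set
  IsSwitching c = ∀ {u v} (e : Edge u v) → c v ≡ σ e *ˢ c u

  -- The sign of a walk telescopes to the quotient of the values of `c` at its two ends, which is
  -- positive when the ends coincide.
  switching⇒balanced : ∀ {c} → IsSwitching c → Balanced Γ
  switching⇒balanced {c} switching {v} w _ = Sign.*-cancelʳ-≡ (c v) _ _ (≡.sym (along w))
    where
    along : ∀ {u v} (w : Walk Γ u v) → c v ≡ walkSign Γ w *ˢ c u
    along []      = ≡.refl
    along {u} {v} (_∷_ {v = x} e w) = begin
      c v                              ≡⟨ along w ⟩
      walkSign Γ w *ˢ c x              ≡⟨ ≡.cong (walkSign Γ w *ˢ_) (switching e) ⟩
      walkSign Γ w *ˢ (σ e *ˢ c u)     ≡⟨ Sign.*-assoc (walkSign Γ w) (σ e) (c u) ⟨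
      walkSign Γ w *ˢ σ e *ˢ c u       ≡⟨ ≡.cong (_*ˢ c u) (Sign.*-comm (walkSign Γ w) (σ e)) ⟩
      σ e *ˢ walkSign Γ w *ˢ c u       ∎

  len : ∀ {u v} → Walk Γ u v → ℕ
  len w = length (vertices Γ w)

  module _ (_≟_ : DecidableEquality V) where

    -- `vertices` omits the end vertex, so an occurrence of `x` has at least one edge after it. The
    -- resulting `0 < len q` is what makes the closed piece of a detour strictly shorter than the
    -- walk.
    split : ∀ {u v x} (w : Walk Γ u v) → x ∈ₗ vertices Γ w →
            Σ[ p ∈ Walk Γ u x ] Σ[ q ∈ Walk Γ x v ]
            walkSign Γ w ≡ walkSign Γ p *ˢ walkSign Γ q × len w ≡ len p ℕ.+ len q × 0 ℕ.< len q
    split (e ∷ w) (here ≡.refl) = [] , e ∷ w , ≡.refl , ≡.refl , ℕ.s≤s ℕ.z≤n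
    split (e ∷ w) (there x∈w)   =
      let p , q , sign , length , nontrivial = split w x∈w
      in e ∷ p , q , ≡.trans (≡.cong (σ e *ˢ_) sign) (≡.sym (Sign.*-assoc (σ e) _ _)) ,
         ≡.cong suc length , nontrivial

    Detour : ∀ {u v} → Walk Γ u v → Set
    Detour {u} {v} w = Σ[ x ∈ V ] Σ[ c ∈ Walk Γ x x ] Σ[ w′ ∈ Walk Γ u v ]
      walkSign Γ w ≡ walkSign Γ c *ˢ walkSign Γ w′ × len c ℕ.< len w × len w′ ℕ.< len w

    -- At a repeated vertex the walk between the two visits is closed and can be cut out. Signs
    -- commute, so the sign of the walk is the product of the signs of the two pieces.
    unique⊎detour : ∀ {u v} (w : Walk Γ u v) → Unique (vertices Γ w) ⊎ Detour w
    unique⊎detour [] = inj₁ AllPairs.[]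
    unique⊎detour (_∷_ {u} e w) with any? (u ≟_) (vertices Γ w)
    ... | yes u∈w = let p , q , sign , length , nontrivial = split w u∈w in
      inj₂ (u , e ∷ p , q ,
        ≡.trans (≡.cong (σ e *ˢ_) sign) (≡.sym (Sign.*-assoc (σ e) _ _)) ,
        ℕ.s≤s (≡.subst (suc (len p) ℕ.≤_) (≡.sym length)
          (ℕ.≤-trans (ℕ.≤-reflexive (ℕ.+-comm 1 (len p))) (ℕ.+-monoʳ-≤ (len p) nontrivial))) ,
        ℕ.s≤s (≡.subst (len q ℕ.≤_) (≡.sym length) (ℕ.m≤n+m (len q) (len p))))
    ... | no u∉w with unique⊎detour w
    ...   | inj₁ unique = inj₁ (¬Any⇒All¬ (vertices Γ w) u∉w AllPairs.∷ unique)
    ...   | inj₂ (x , c , w′ , sign , c<w , w′<w) = inj₂ (x , c , e ∷ w′ , (begin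
      σ e *ˢ walkSign Γ w                     ≡⟨ ≡.cong (σ e *ˢ_) sign ⟩
      σ e *ˢ (walkSign Γ c *ˢ walkSign Γ w′)  ≡⟨ Sign.*-assoc (σ e) _ _ ⟨
      σ e *ˢ walkSign Γ c *ˢ walkSign Γ w′    ≡⟨ ≡.cong (_*ˢ walkSign Γ w′) (Sign.*-comm (σ e) (walkSign Γ c)) ⟩
      walkSign Γ c *ˢ σ e *ˢ walkSign Γ w′    ≡⟨ Sign.*-assoc (walkSign Γ c) _ _ ⟩
      walkSign Γ c *ˢ (σ e *ˢ walkSign Γ w′)  ∎) , ℕ.m<n⇒m<1+n c<w , ℕ.s≤s w′<w)

    module _ (balanced : Balanced Γ) where

      unique-closed-positive : ∀ {v} (w : Walk Γ v v) → Unique (vertices Γ w) → walkSign Γ w ≡ Sign.+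
      unique-closed-positive []              _ = ≡.refl
      unique-closed-positive w@(_ ∷ [])      unique = balanced w (unique , (λ ()) , (λ ()))
      -- Length 2 does not count as a cycle, so balance says nothing here; the walk returns along
      -- its first edge and its sign is a square.
      unique-closed-positive (e ∷ (e′ ∷ [])) _ = begin
        σ e *ˢ (σ e′ *ˢ Sign.+)  ≡⟨ ≡.cong (σ e *ˢ_) (≡.trans (Sign.*-identityʳ _) (σ-sym e′ e)) ⟩
        σ e *ˢ σ e               ≡⟨ Sign.s*s≡+ (σ e) ⟩
        Sign.+                   ∎
      unique-closed-positive w@(_ ∷ (_ ∷ (_ ∷ _))) unique = balanced w (unique , (λ ()) , (λ ()))

      -- Strong induction on length: cutting a detour out of a closed walk leaves two shorter closed
      -- walks.
      closed-positive : ∀ {v} (w : Walk Γ v v) → walkSign Γ w ≡ Sign.+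
      closed-positive w = below (suc (len w)) w ℕ.≤-refl
        where
        below : ∀ n {v} (w : Walk Γ v v) → len w ℕ.< n → walkSign Γ w ≡ Sign.+
        below (suc n) w (ℕ.s≤s w≤n) with unique⊎detour w
        ... | inj₁ unique = unique-closed-positive w unique
        ... | inj₂ (_ , c , w′ , sign , c<w , w′<w) = ≡.trans sign
          (≡.cong₂ _*ˢ_ (below n c (ℕ.<-≤-trans c<w w≤n)) (below n w′ (ℕ.<-≤-trans w′<w w≤n)))

      record Anchor (v : V) : Set where
        field
          root : V
          path : Walk Γ root v
        sgn : Sign
        sgn = walkSign Γ path

      open Anchor

      -- The condition on a pair presupposes an edge, so the induction may run through all pairs of
      -- vertices instead of a list of edges.
      Respects : (∀ v → Anchor v) → V × V → Set
      Respects A (a , b) = (e : Edge a b) → root (A a) ≡ root (A b) × sgn (A b) ≡ σ e *ˢ sgn (A a)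

      -- A union–find in which every vertex stores a walk from the representative of its class.
      -- An edge inside a class closes up to a closed walk, so balance gives it the right sign;
      -- an edge between two classes merges them along itself.
      anchors : (L : List (V × V)) → Σ[ A ∈ (∀ v → Anchor v) ] (∀ {q} → q ∈ₗ L → Respects A q)
      anchors [] = (λ v → record { root = v ; path = [] }) , λ ()
      anchors ((a , b) ∷ L) with anchors L
      ... | A , respects with edge? a b
      ...   | no ¬e = A , λ { (here ≡.refl) e → ⊥-elim (¬e e) ; (there q∈L) → respects q∈L }
      ...   | yes e with root (A a) ≟ root (A b)
      ...     | yes eq = A , λ { (here ≡.refl) e′ → eq , ≡.trans closing (≡.cong (_*ˢ sgn (A a)) (σ-irrelevant e e′))
                               ; (there q∈L) → respects q∈L }
        where
        solve-sign : ∀ x y z → x *ˢ (y *ˢ z) ≡ Sign.+ → z ≡ y *ˢ x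
        solve-sign Sign.+ Sign.+ Sign.+ _ = ≡.refl
        solve-sign Sign.+ Sign.- Sign.- _ = ≡.refl
        solve-sign Sign.- Sign.+ Sign.- _ = ≡.refl
        solve-sign Sign.- Sign.- Sign.+ _ = ≡.refl
        closed : ∀ {r} (q : Walk Γ r b) → root (A a) ≡ r → walkSign Γ q ≡ σ e *ˢ sgn (A a)
        closed q ≡.refl = solve-sign (sgn (A a)) (σ e) (walkSign Γ q) (begin
          sgn (A a) *ˢ (σ e *ˢ walkSign Γ q)            ≡⟨ ≡.cong (λ s → sgn (A a) *ˢ (σ e *ˢ s)) (sign-reverse q) ⟨
          sgn (A a) *ˢ (σ e *ˢ walkSign Γ (reverseʷ q)) ≡⟨ sign-++ (path (A a)) (e ∷ reverseʷ q) ⟨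
          walkSign Γ (path (A a) ++ʷ (e ∷ reverseʷ q))  ≡⟨ closed-positive (path (A a) ++ʷ (e ∷ reverseʷ q)) ⟩
          Sign.+                                        ∎)
        closing : sgn (A b) ≡ σ e *ˢ sgn (A a)
        closing = closed (path (A b)) eq
      ...     | no ra≢rb = (λ v → move v (root (A v) ≟ root (A b))) , λ { (here ≡.refl) → merged ; (there q∈L) → kept (respects q∈L) }
        where
        bridge : Walk Γ (root (A a)) (root (A b))
        bridge = path (A a) ++ʷ (e ∷ reverseʷ (path (A b)))
        transfer : ∀ {r v} → r ≡ root (A b) → Walk Γ r v → Walk Γ (root (A a)) v
        transfer ≡.refl w = bridge ++ʷ w
        sign-transfer : ∀ {r v} (eq : r ≡ root (A b)) (w : Walk Γ r v) →
                        walkSign Γ (transfer eq w) ≡ walkSign Γ bridge *ˢ walkSign Γ w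
        sign-transfer ≡.refl w = sign-++ bridge w
        move : ∀ v → Dec (root (A v) ≡ root (A b)) → Anchor v
        move v (yes eq) = record { root = root (A a) ; path = transfer eq (path (A v)) }
        move v (no _)   = A v
        -- An edge treated earlier has both ends in one class, so either both ends move or neither
        -- does. If they move, both signs gain the same factor, the sign of the bridge.
        kept : ∀ {q} → Respects A q → Respects (λ v → move v (root (A v) ≟ root (A b))) q
        kept {c , d} respected f with respected f | root (A c) ≟ root (A b) | root (A d) ≟ root (A b)
        ... | rc≡rd , sd | yes eqc | yes eqd = ≡.refl , (begin
          walkSign Γ (transfer eqd (path (A d)))           ≡⟨ sign-transfer eqd (path (A d)) ⟩
          k *ˢ sgn (A d)                                   ≡⟨ ≡.cong (k *ˢ_) sd ⟩
          k *ˢ (σ f *ˢ sgn (A c))                          ≡⟨ Sign.*-assoc k (σ f) _ ⟨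
          k *ˢ σ f *ˢ sgn (A c)                            ≡⟨ ≡.cong (_*ˢ sgn (A c)) (Sign.*-comm k (σ f)) ⟩
          σ f *ˢ k *ˢ sgn (A c)                            ≡⟨ Sign.*-assoc (σ f) k _ ⟩
          σ f *ˢ (k *ˢ sgn (A c))                          ≡⟨ ≡.cong (σ f *ˢ_) (sign-transfer eqc (path (A c))) ⟨
          σ f *ˢ walkSign Γ (transfer eqc (path (A c)))    ∎)
          where k = walkSign Γ bridge
        ... | rc≡rd , sd | yes eqc | no ned  = ⊥-elim (ned (≡.trans (≡.sym rc≡rd) eqc))
        ... | rc≡rd , sd | no nec  | yes eqd = ⊥-elim (nec (≡.trans rc≡rd eqd))
        ... | rc≡rd , sd | no _    | no _    = rc≡rd , sd
        -- Here `a` stays and `b` moves. The new walk to `b` traverses the old one twice, once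
        -- backwards inside the bridge, so that sign squares away and the sign of the edge times
        -- that of `a` remains.
        merged : Respects (λ v → move v (root (A v) ≟ root (A b))) (a , b)
        merged f with root (A a) ≟ root (A b) | root (A b) ≟ root (A b)
        ... | yes eq | _      = ⊥-elim (ra≢rb eq)
        ... | no _   | no neq = ⊥-elim (neq ≡.refl)
        ... | no _   | yes eq = ≡.refl , (begin
          walkSign Γ (transfer eq (path (A b)))                     ≡⟨ sign-transfer eq (path (A b)) ⟩
          walkSign Γ bridge *ˢ sgn (A b)                            ≡⟨ ≡.cong (_*ˢ sgn (A b)) (sign-++ (path (A a)) (e ∷ reverseʷ (path (A b)))) ⟩
          sgn (A a) *ˢ (σ e *ˢ walkSign Γ (reverseʷ (path (A b)))) *ˢ sgn (A b)
            ≡⟨ ≡.cong₂ (λ s r → sgn (A a) *ˢ (s *ˢ r) *ˢ sgn (A b)) (σ-irrelevant e f) (sign-reverse (path (A b))) ⟩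
          sgn (A a) *ˢ (σ f *ˢ sgn (A b)) *ˢ sgn (A b)              ≡⟨ cancel (sgn (A a)) (σ f) (sgn (A b)) ⟩
          σ f *ˢ sgn (A a)                                          ∎)
          where
          cancel : ∀ x y z → x *ˢ (y *ˢ z) *ˢ z ≡ y *ˢ x
          cancel x y z = begin
            x *ˢ (y *ˢ z) *ˢ z    ≡⟨ Sign.*-assoc x (y *ˢ z) z ⟩
            x *ˢ (y *ˢ z *ˢ z)    ≡⟨ ≡.cong (x *ˢ_) (Sign.*-assoc y z z) ⟩
            x *ˢ (y *ˢ (z *ˢ z))  ≡⟨ ≡.cong (λ s → x *ˢ (y *ˢ s)) (Sign.s*s≡+ z) ⟩
            x *ˢ (y *ˢ Sign.+)    ≡⟨ ≡.cong (x *ˢ_) (Sign.*-identityʳ y) ⟩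
            x *ˢ y                ≡⟨ Sign.*-comm x y ⟩
            y *ˢ x                ∎

      balanced⇒switching : (vs : List V) → (∀ v → v ∈ₗ vs) → Σ[ c ∈ (V → Sign) ] IsSwitching c
      balanced⇒switching vs complete = let A , respects = anchors (cartesianProduct vs vs) in
        (λ v → sgn (A v)) , λ e → proj₂ (respects (∈-cartesianProduct⁺ (complete _) (complete _)) e)

-- Balanced sets of -G are the sets inducing bipartite subgraphs.

module _ {V : Set} where

  ⟪⟫-≡ : {U : Subset V} {u v : ⟪ U ⟫} → proj₁ u ≡ proj₁ v → u ≡ v
  ⟪⟫-≡ ≡.refl = ≡.cong (_ ,_) (T-irrelevant _ _)

  ⟪⟫-≟ : DecidableEquality V → (U : Subset V) → DecidableEquality ⟪ U ⟫
  ⟪⟫-≟ _≟_ U u v = map′ ⟪⟫-≡ (≡.cong proj₁) (proj₁ u ≟ proj₁ v)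

  members : (U : Subset V) → List V → List ⟪ U ⟫
  members U []       = []
  members U (v ∷ vs) with T? (U v)
  ... | yes v∈U = (v , v∈U) ∷ members U vs
  ... | no  _   = members U vs

  ∈-members : ∀ U {vs} (u : ⟪ U ⟫) → proj₁ u ∈ₗ vs → u ∈ₗ members U vs
  ∈-members U {v ∷ vs} u u∈vs with T? (U v)
  ∈-members U {v ∷ vs} u       (here u≡v)    | yes _   = here (⟪⟫-≡ u≡v)
  ∈-members U {v ∷ vs} u       (there u∈vs)  | yes _   = there (∈-members U u u∈vs)
  ∈-members U {v ∷ vs} (_ , p) (here ≡.refl) | no v∉U  = ⊥-elim (v∉U p)
  ∈-members U {v ∷ vs} u       (there u∈vs)  | no _    = ∈-members U u u∈vs

module _ {V : Set} {{finite : Finite V}} (G : SimpleGraph V) (U : Subset V) where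
  open Walks (neg G [ U ]ˢ)

  private
    sign : Bool → Sign
    sign true  = Sign.+
    sign false = Sign.-

    colour : Sign → Bool
    colour Sign.+ = true
    colour Sign.- = false

    sign-≢ : ∀ {a b} → a ≢ b → sign b ≡ Sign.- *ˢ sign a
    sign-≢ {true}  {true}  a≢b = ⊥-elim (a≢b ≡.refl)
    sign-≢ {true}  {false} a≢b = ≡.refl
    sign-≢ {false} {true}  a≢b = ≡.refl
    sign-≢ {false} {false} a≢b = ⊥-elim (a≢b ≡.refl)

    colour-≢ : ∀ {s r} → r ≡ Sign.- *ˢ s → colour s ≢ colour r
    colour-≢ {Sign.+} ≡.refl ()
    colour-≢ {Sign.-} ≡.refl ()

  -- A proper colouring read as signs is a switching function: it changes along each negative edge
  -- and is constant along each positive loop.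
  bipartite⇒balanced : Bipartite (G [ U ]) → BalancedSet (neg G) U
  bipartite⇒balanced (c , proper) = switching⇒balanced {c = λ u → sign (c u)} λ
    { (inj₁ u≡v) → ≡.cong (λ u → sign (c u)) (⟪⟫-≡ (≡.sym u≡v))
    ; (inj₂ e)   → sign-≢ (proper e) }

  balanced⇒bipartite : BalancedSet (neg G) U → Bipartite (G [ U ])
  balanced⇒bipartite balanced =
    let c , switching = balanced⇒switching (⟪⟫-≟ _≟_ U) balanced
          (members U (tabulate element)) (λ u → ∈-members U u (listed (proj₁ u)))
    in (λ u → colour (c u)) , λ e → colour-≢ (switching (inj₂ e))
    where
    open Finite finite
    listed : ∀ v → v ∈ₗ tabulate element
    listed v = ≡.subst (_∈ₗ tabulate element) (Inverse.strictlyInverseʳ enum v) (∈-tabulate⁺ (Inverse.to enum v))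

conv-mono : (ℝ : CompleteOrderedField) {V : Set} (S S′ : Vector ℝ V → Set) →
            (∀ {x} → S x → S′ x) → ∀ {x} → conv ℝ S x → conv ℝ S′ x
conv-mono ℝ S S′ S⊆S′ (k , λs , ps , members , combination) = k , λs , ps , (λ i → S⊆S′ (members i)) , combination

BSTAB≐BIP : (ℝ : CompleteOrderedField) {V : Set} {{finite : Finite V}} (G : SimpleGraph V) →
            BSTAB ℝ (neg G) ≐ BIP ℝ G
BSTAB≐BIP ℝ {V} G =
  conv-mono ℝ BalancedIndicator BipartiteIndicator (λ (B , balanced , x≈) → B , balanced⇒bipartite G B balanced , x≈) ,
  conv-mono ℝ BipartiteIndicator BalancedIndicator (λ (U , bipartite , x≈) → U , bipartite⇒balanced G U bipartite , x≈)
  where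
  BalancedIndicator BipartiteIndicator : Vector ℝ V → Set
  BalancedIndicator x  = ∃[ B ] BalancedSet (neg G) B × _≈ᵛ_ ℝ x (𝟏[_] ℝ B)
  BipartiteIndicator x = ∃[ U ] Bipartite (G [ U ]) × _≈ᵛ_ ℝ x (𝟏[_] ℝ U)

-- A ring solver with integer coefficients.

module IntegerCoefficients (R : CommutativeRing 0ℓ 0ℓ) where
  open CommutativeRing R
  open RingProperties ring
  open SemiringMult semiring using (×-homo-+; ×1-homo-*) renaming (_×_ to _·_)
  open import Relation.Binary.Reasoning.Setoid setoid

  -- The canonical homomorphism from the integers. It gives the solver coefficients that compute, so
  -- that normal forms can be compared.
  fromℤ : ℤ → Carrier
  fromℤ (+ n)    = n · 1#
  fromℤ -[1+ n ] = - (suc n · 1#)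

  private
    suc-· : ∀ n → suc n · 1# ≈ 1# + n · 1#
    suc-· n = ×-homo-+ 1# 1 n

    fromℤ-⊖ : ∀ m n → fromℤ (m ⊖ n) ≈ m · 1# + - (n · 1#)
    fromℤ-⊖ m       zero    = sym (trans (+-congˡ -0#≈0#) (+-identityʳ _))
    fromℤ-⊖ zero    (suc n) = sym (+-identityˡ _)
    fromℤ-⊖ (suc m) (suc n) = begin
      fromℤ (suc m ⊖ suc n)                        ≡⟨ ≡.cong fromℤ (ℤ.[1+m]⊖[1+n]≡m⊖n m n) ⟩
      fromℤ (m ⊖ n)                                ≈⟨ fromℤ-⊖ m n ⟩
      m · 1# + - (n · 1#)                          ≈⟨ +-congʳ (xyx⁻¹≈y 1# (m · 1#)) ⟨
      (1# + m · 1# + - 1#) + - (n · 1#)            ≈⟨ +-assoc _ _ _ ⟩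
      (1# + m · 1#) + (- 1# + - (n · 1#))          ≈⟨ +-congˡ (-‿+-comm 1# (n · 1#)) ⟩
      (1# + m · 1#) + - (1# + n · 1#)              ≈⟨ +-cong (suc-· m) (-‿cong (suc-· n)) ⟨
      suc m · 1# + - (suc n · 1#)                  ∎

    fromℤ-+ : ∀ i j → fromℤ (i ℤ.+ j) ≈ fromℤ i + fromℤ j
    fromℤ-+ (+ m)    (+ n)    = ×-homo-+ 1# m n
    fromℤ-+ (+ m)    -[1+ n ] = fromℤ-⊖ m (suc n)
    fromℤ-+ -[1+ m ] (+ n)    = trans (fromℤ-⊖ n (suc m)) (+-comm _ _)
    fromℤ-+ -[1+ m ] -[1+ n ] = begin
      - (suc (suc (m ℕ.+ n)) · 1#)          ≡⟨ ≡.cong (λ k → - (suc k · 1#)) (ℕ.+-suc m n) ⟨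
      - ((suc m ℕ.+ suc n) · 1#)            ≈⟨ -‿cong (×-homo-+ 1# (suc m) (suc n)) ⟩
      - (suc m · 1# + suc n · 1#)           ≈⟨ -‿+-comm _ _ ⟨
      - (suc m · 1#) + - (suc n · 1#)       ∎

    fromℤ-neg : ∀ i → fromℤ (ℤ.- i) ≈ - fromℤ i
    fromℤ-neg (+ zero)  = sym -0#≈0#
    fromℤ-neg (+ suc n) = refl
    fromℤ-neg -[1+ n ]  = sym (-‿involutive _)

    fromℤ-*⁺ : ∀ m j → fromℤ (+ m ℤ.* j) ≈ m · 1# * fromℤ j
    fromℤ-*⁺ m (+ n) = begin
      fromℤ (+ m ℤ.* + n)     ≡⟨ ≡.cong fromℤ (ℤ.pos-* m n) ⟨
      (m ℕ.* n) · 1#          ≈⟨ ×1-homo-* m n ⟩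
      m · 1# * (n · 1#)       ∎
    fromℤ-*⁺ m -[1+ n ] = begin
      fromℤ (+ m ℤ.* -[1+ n ])           ≡⟨ ≡.cong fromℤ (ℤ.neg-distribʳ-* (+ m) (+ suc n)) ⟨
      fromℤ (ℤ.- (+ m ℤ.* + suc n))      ≈⟨ fromℤ-neg (+ m ℤ.* + suc n) ⟩
      - fromℤ (+ m ℤ.* + suc n)          ≈⟨ -‿cong (fromℤ-*⁺ m (+ suc n)) ⟩
      - (m · 1# * (suc n · 1#))          ≈⟨ -‿distribʳ-* _ _ ⟩
      m · 1# * - (suc n · 1#)            ∎

    fromℤ-* : ∀ i j → fromℤ (i ℤ.* j) ≈ fromℤ i * fromℤ j
    fromℤ-* (+ m)    j = fromℤ-*⁺ m j
    fromℤ-* -[1+ m ] j = begin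
      fromℤ (-[1+ m ] ℤ.* j)          ≡⟨ ≡.cong fromℤ (ℤ.neg-distribˡ-* (+ suc m) j) ⟨
      fromℤ (ℤ.- (+ suc m ℤ.* j))     ≈⟨ fromℤ-neg (+ suc m ℤ.* j) ⟩
      - fromℤ (+ suc m ℤ.* j)         ≈⟨ -‿cong (fromℤ-*⁺ (suc m) j) ⟩
      - (suc m · 1# * fromℤ j)        ≈⟨ -‿distribˡ-* _ _ ⟩
      - (suc m · 1#) * fromℤ j        ∎

    morphism : ℤ.+-*-rawRing -Raw-AlmostCommutative⟶ fromCommutativeRing R
    morphism = record
      { ⟦_⟧    = fromℤ
      ; +-homo = fromℤ-+
      ; *-homo = fromℤ-*
      ; -‿homo = fromℤ-neg
      ; 0-homo = refl
      ; 1-homo = refl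
      }

    fromℤ≈? : ∀ i j → Maybe (fromℤ i ≈ fromℤ j)
    fromℤ≈? i j = Maybe.map (reflexive ∘ ≡.cong fromℤ) (dec⇒weaklyDec ℤ._≟_ i j)

  open RingSolver ℤ.+-*-rawRing (fromCommutativeRing R) morphism fromℤ≈? public
    using (solve; _:=_; _:+_; _:*_; :-_; con)

-- Arithmetic of the ordered field.

module OrderedField (ℝ : CompleteOrderedField) where
  open CompleteOrderedField ℝ public
  open CommutativeRing commutativeRing public
    using ( semiring; refl; sym; trans; reflexive
          ; +-cong; +-congˡ; +-congʳ; *-cong; *-congˡ; *-congʳ; -‿cong
          ; +-identityˡ; +-identityʳ; +-comm; +-assoc; *-identityˡ; *-identityʳ
          ; *-comm; zeroˡ; zeroʳ; -‿inverseʳ)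
  open IsDecTotalOrder isDecTotalOrder public
    using (_≤?_; total; antisym; isPartialOrder)
    renaming (_≟_ to _≈?_; refl to ≤-refl; trans to ≤-trans; reflexive to ≤-reflexive)
  open IntegerCoefficients commutativeRing public

  poset : Poset 0ℓ 0ℓ 0ℓ
  poset = record { isPartialOrder = isPartialOrder }

  open import Relation.Binary.Reasoning.PartialOrder poset public
    using (begin_; begin-equality_; step-≈-⟩; step-≈-⟨; step-≤; step-≡-⟩; _∎)

  infix 4 _<_
  _<_ : Carrier → Carrier → Set
  x < y = ¬ (y ≤ x)

  <⇒≤ : ∀ {x y} → x < y → x ≤ y
  <⇒≤ {x} {y} x<y = [ (λ x≤y → x≤y) , ⊥-elim ∘ x<y ]′ (total x y)

  +-mono-≤ : ∀ {a b c d} → a ≤ b → c ≤ d → a + c ≤ b + d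
  +-mono-≤ {a} {b} {c} {d} a≤b c≤d = begin
    a + c ≤⟨ +-monoʳ-≤ a c≤d ⟩
    a + d ≈⟨ +-comm a d ⟩
    d + a ≤⟨ +-monoʳ-≤ d a≤b ⟩
    d + b ≈⟨ +-comm d b ⟩
    b + d ∎

  +-nonneg : ∀ {x y} → 0# ≤ x → 0# ≤ y → 0# ≤ x + y
  +-nonneg 0≤x 0≤y = ≤-trans (≤-reflexive (sym (+-identityˡ 0#))) (+-mono-≤ 0≤x 0≤y)

  0≤y-x⇒x≤y : ∀ {x y} → 0# ≤ y + - x → x ≤ y
  0≤y-x⇒x≤y {x} {y} h = begin
    x             ≈⟨ +-identityʳ x ⟨
    x + 0#        ≤⟨ +-monoʳ-≤ x h ⟩
    x + (y + - x) ≈⟨ solve 2 (λ a b → a :+ (b :+ :- a) := b) refl x y ⟩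
    y             ∎

  x≤y⇒0≤y-x : ∀ {x y} → x ≤ y → 0# ≤ y + - x
  x≤y⇒0≤y-x {x} {y} x≤y = begin
    0#      ≈⟨ -‿inverseʳ x ⟨
    x + - x ≤⟨ +-mono-≤ x≤y ≤-refl ⟩
    y + - x ∎

  -- Reduces an inequality to a ring identity: exhibit y − x as a nonnegative element.
  ≤-from : ∀ {x y} d → 0# ≤ d → y + - x ≈ d → x ≤ y
  ≤-from d 0≤d eq = 0≤y-x⇒x≤y (≤-trans 0≤d (≤-reflexive (sym eq)))

  x*x≥0 : ∀ x → 0# ≤ x * x
  x*x≥0 x with total 0# x
  ... | inj₁ 0≤x = *-nonneg 0≤x 0≤x
  ... | inj₂ x≤0 = begin
    0#                        ≤⟨ *-nonneg (x≤y⇒0≤y-x x≤0) (x≤y⇒0≤y-x x≤0) ⟩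
    (0# + - x) * (0# + - x)   ≈⟨ solve 1 (λ a → (con (+ 0) :+ :- a) :* (con (+ 0) :+ :- a) := a :* a) refl x ⟩
    x * x                     ∎

  0≤1 : 0# ≤ 1#
  0≤1 = ≤-trans (x*x≥0 1#) (≤-reflexive (*-identityˡ 1#))

  0<1 : 0# < 1#
  0<1 1≤0 = 0≉1 (antisym 0≤1 1≤0)

  *-monoˡ-≤ : ∀ {c x y} → 0# ≤ c → x ≤ y → c * x ≤ c * y
  *-monoˡ-≤ {c} {x} {y} 0≤c x≤y = ≤-from (c * (y + - x)) (*-nonneg 0≤c (x≤y⇒0≤y-x x≤y))
    (solve 3 (λ c x y → c :* y :+ :- (c :* x) := c :* (y :+ :- x)) refl c x y)

  neg-antimono-≤ : ∀ {x y} → x ≤ y → - y ≤ - x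
  neg-antimono-≤ {x} {y} x≤y = ≤-from (y + - x) (x≤y⇒0≤y-x x≤y)
    (solve 2 (λ x y → :- x :+ :- (:- y) := y :+ :- x) refl x y)

  <-≤-trans : ∀ {x y z} → x < y → y ≤ z → x < z
  <-≤-trans x<y y≤z z≤x = x<y (≤-trans y≤z z≤x)

  pos⇒≉0 : ∀ {x} → 0# < x → ¬ (x ≈ 0#)
  pos⇒≉0 0<x x≈0 = 0<x (≤-reflexive x≈0)

  recip-pos : ∀ {x y} → 0# < x → x * y ≈ 1# → 0# < y
  recip-pos {x} {y} 0<x xy≈1 y≤0 = 0<1 (≤-from (x * (0# + - y))
    (*-nonneg (<⇒≤ 0<x) (x≤y⇒0≤y-x y≤0))
    (begin-equality
      0# + - 1#       ≈⟨ +-congˡ (-‿cong xy≈1) ⟨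
      0# + - (x * y)  ≈⟨ solve 2 (λ x y → con (+ 0) :+ :- (x :* y) := x :* (con (+ 0) :+ :- y)) refl x y ⟩
      x * (0# + - y)  ∎))

  recip : ∀ {x} → 0# < x → ∃[ y ] x * y ≈ 1# × 0# < y
  recip 0<x = let y , xy≈1 = inverse _ (pos⇒≉0 0<x) in y , xy≈1 , recip-pos 0<x xy≈1

  *-pos : ∀ {x y} → 0# < x → 0# < y → 0# < x * y
  *-pos {x} {y} 0<x 0<y xy≤0 = 0<y (begin
    y            ≈⟨ *-identityˡ y ⟨
    1# * y       ≈⟨ *-congʳ xi≈1 ⟨
    x * i * y    ≈⟨ solve 3 (λ x i y → x :* i :* y := i :* (x :* y)) refl x i y ⟩
    i * (x * y)  ≤⟨ *-monoˡ-≤ (<⇒≤ 0<i) xy≤0 ⟩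
    i * 0#       ≈⟨ zeroʳ i ⟩
    0#           ∎)
    where
    i = proj₁ (recip 0<x)
    xi≈1 = proj₁ (proj₂ (recip 0<x))
    0<i = proj₂ (proj₂ (recip 0<x))

  nonneg+1-pos : ∀ {x} → 0# ≤ x → 0# < x + 1#
  nonneg+1-pos {x} 0≤x x+1≤0 = 0<1 (begin
    1#      ≈⟨ +-identityˡ 1# ⟨
    0# + 1# ≤⟨ +-mono-≤ 0≤x ≤-refl ⟩
    x + 1#  ≤⟨ x+1≤0 ⟩
    0#      ∎)

  x<x+ε : ∀ {x ε} → 0# < ε → x < x + ε
  x<x+ε {x} {ε} 0<ε h = 0<ε (begin
    ε               ≈⟨ solve 2 (λ x e → e := (x :+ e) :+ :- x) refl x ε ⟩
    (x + ε) + - x   ≤⟨ +-mono-≤ h ≤-refl ⟩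
    x + - x         ≈⟨ -‿inverseʳ x ⟩
    0#              ∎)

  double-cancel-≤ : ∀ {x y} → x + x ≤ y + y → x ≤ y
  double-cancel-≤ {x} {y} h with total x y
  ... | inj₁ x≤y = x≤y
  -- No division by 2: y - x is the sum of 2y - 2x and x - y, both nonnegative in this case.
  ... | inj₂ y≤x = ≤-from ((y + y + - (x + x)) + (x + - y))
    (+-nonneg (x≤y⇒0≤y-x h) (x≤y⇒0≤y-x y≤x))
    (solve 2 (λ x y → y :+ :- x := (y :+ y :+ :- (x :+ x)) :+ (x :+ :- y)) refl x y)

  ≤-stable : ∀ {x y} → ¬ ¬ (x ≤ y) → x ≤ y
  ≤-stable {x} {y} = decidable-stable (x ≤? y)

  -- If d = x - y were positive, ε = d / (K + 1) would give d ≤ K d / (K + 1), hence d / (K + 1) ≤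
  -- 0. Dividing by K + 1 also covers K = 0.
  ≤-archimedean : ∀ {x y} K → 0# ≤ K → (∀ {ε} → 0# < ε → x ≤ y + K * ε) → x ≤ y
  ≤-archimedean {x} {y} K 0≤K h with x ≤? y
  ... | yes x≤y = x≤y
  ... | no  y<x = ⊥-elim (*-pos 0<d 0<i (begin
    d * i                          ≈⟨ solve 3 (λ d K i → d :* i := :- (K :* (d :* i)) :+ (K :+ con (+ 1)) :* i :* d) refl d K i ⟩
    - (K * (d * i)) + (K + 1#) * i * d ≈⟨ +-congˡ (trans (*-congʳ Ki≈1) (*-identityˡ d)) ⟩
    - (K * (d * i)) + d            ≈⟨ solve 3 (λ x y k → :- k :+ (x :+ :- y) := :- (y :+ k) :+ x) refl x y (K * (d * i)) ⟩
    - (y + K * (d * i)) + x        ≤⟨ +-mono-≤ (neg-antimono-≤ (h (*-pos 0<d 0<i))) ≤-refl ⟩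
    - x + x                        ≈⟨ solve 1 (λ x → :- x :+ x := con (+ 0)) refl x ⟩
    0#                             ∎))
    where
    d = x + - y
    0<d : 0# < d
    0<d d≤0 = y<x (≤-from (- d) (begin
      0#     ≈⟨ solve 0 (con (+ 0) := :- con (+ 0)) refl ⟩
      - 0#   ≤⟨ neg-antimono-≤ d≤0 ⟩
      - d    ∎) (solve 2 (λ x y → y :+ :- x := :- (x :+ :- y)) refl x y))
    i = proj₁ (recip (nonneg+1-pos 0≤K))
    Ki≈1 = proj₁ (proj₂ (recip (nonneg+1-pos 0≤K)))
    0<i = proj₂ (proj₂ (recip (nonneg+1-pos 0≤K)))

-- Finite sums over enumerated types.

module Sums (ℝ : CompleteOrderedField) where
  open OrderedField ℝ
  open SemiringSum semiring
    using (sum; sum-cong-≋; ∑-distrib-+; *-distribˡ-sum; ∑-comm; sum-permute; sum-remove; sum-replicate-zero)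

  private
    variable
      V W : Set

  sum-mono : ∀ {n} {f g : Fin n → Carrier} → (∀ i → f i ≤ g i) → sum f ≤ sum g
  sum-mono {zero}  h = ≤-refl
  sum-mono {suc n} h = +-mono-≤ (h zero) (sum-mono (h ∘ suc))

  sum-single : ∀ {n} (f : Fin n → Carrier) i → (∀ j → j ≢ i → f j ≈ 0#) → sum f ≈ f i
  sum-single {suc n} f i h = begin-equality
    sum f                            ≈⟨ sum-remove {i = i} f ⟩
    f i + sum (λ j → f (punchIn i j)) ≈⟨ +-congˡ (sum-cong-≋ (λ j → h _ (punchInᵢ≢i i j))) ⟩
    f i + sum {n} (λ _ → 0#)         ≈⟨ +-congˡ (sum-replicate-zero n) ⟩
    f i + 0#                         ≈⟨ +-identityʳ _ ⟩
    f i                              ∎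

  sum-splitAt : ∀ m {n} (f : Fin m ⊎ Fin n → Carrier) →
                sum (f ∘ splitAt m) ≈ sum (f ∘ inj₁) + sum (f ∘ inj₂)
  sum-splitAt zero    f = sym (+-identityˡ _)
  sum-splitAt (suc m) f = begin-equality
    f (inj₁ zero) + sum (f ∘ map₁ suc ∘ splitAt m) ≈⟨ +-congˡ (sum-splitAt m (f ∘ map₁ suc)) ⟩
    f (inj₁ zero) + (sum (f ∘ inj₁ ∘ suc) + sum (f ∘ inj₂)) ≈⟨ +-assoc _ _ _ ⟨
    f (inj₁ zero) + sum (f ∘ inj₁ ∘ suc) + sum (f ∘ inj₂) ∎

  -- `remQuot` is the enumeration behind `×-finite`, so this is what turns a sum over a product type
  -- into an iterated sum.
  sum-remQuot : ∀ m n (f : Fin m × Fin n → Carrier) →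
                sum (f ∘ remQuot {m} n) ≈ sum (λ i → sum (λ j → f (i , j)))
  sum-remQuot zero    n f = refl
  sum-remQuot (suc m) n f = begin-equality
    sum (f ∘ remQuot {suc m} n)
      ≈⟨ sum-cong-≋ (λ i → reflexive (split i)) ⟩
    sum (g ∘ splitAt n)
      ≈⟨ sum-splitAt n g ⟩
    sum (λ j → f (zero , j)) + sum (f ∘ Product.map₁ suc ∘ remQuot {m} n)
      ≈⟨ +-congˡ (sum-remQuot m n (f ∘ Product.map₁ suc)) ⟩
    sum (λ j → f (zero , j)) + sum (λ i → sum (λ j → f (suc i , j))) ∎
    where
    g : Fin n ⊎ Fin (m ℕ.* n) → Carrier
    g = [ (λ j → f (zero , j)) , f ∘ Product.map₁ suc ∘ remQuot {m} n ]′
    split : ∀ i → f (remQuot {suc m} n i) ≡ g (splitAt n i)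
    split i with splitAt n i
    ... | inj₁ _ = ≡.refl
    ... | inj₂ _ = ≡.refl

  module _ {{fin : Finite V}} where
    open Finite fin using (size; enum; element)

    ∑-cong : {f g : V → Carrier} → (∀ v → f v ≈ g v) → ∑ ℝ f ≈ ∑ ℝ g
    ∑-cong h = sum-cong-≋ (h ∘ element)

    ∑-+ : (f g : V → Carrier) → ∑ ℝ (λ v → f v + g v) ≈ ∑ ℝ f + ∑ ℝ g
    ∑-+ f g = ∑-distrib-+ (f ∘ element) (g ∘ element)

    ∑-* : ∀ c (f : V → Carrier) → ∑ ℝ (λ v → c * f v) ≈ c * ∑ ℝ f
    ∑-* c f = sym (*-distribˡ-sum c (f ∘ element))

    ∑-0 : ∑ ℝ {V} (λ _ → 0#) ≈ 0#
    ∑-0 = sum-replicate-zero size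

    ∑-mono : {f g : V → Carrier} → (∀ v → f v ≤ g v) → ∑ ℝ f ≤ ∑ ℝ g
    ∑-mono h = sum-mono (h ∘ element)

    ∑-nonneg : {f : V → Carrier} → (∀ v → 0# ≤ f v) → 0# ≤ ∑ ℝ f
    ∑-nonneg h = ≤-trans (≤-reflexive (sym ∑-0)) (∑-mono h)

    element-to : ∀ v → element (Inverse.to enum v) ≡ v
    element-to = Inverse.strictlyInverseʳ enum

    ∑-single : (f : V → Carrier) (u : V) → (∀ v → v ≢ u → f v ≈ 0#) → ∑ ℝ f ≈ f u
    ∑-single f u h = begin-equality
      ∑ ℝ f                         ≈⟨ sum-single (f ∘ element) (Inverse.to enum u)
        (λ i i≢u → h _ (λ eq → i≢u (≡.trans (≡.sym (Inverse.strictlyInverseˡ enum i)) (≡.cong (Inverse.to enum) eq)))) ⟩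
      f (element (Inverse.to enum u)) ≡⟨ ≡.cong f (element-to u) ⟩
      f u                           ∎

  module _ {{finV : Finite V}} {{finW : Finite W}} where
    private
      module V = Finite finV
      module W = Finite finW

    ∑-swap : (f : V → W → Carrier) →
             ∑ ℝ (λ v → ∑ ℝ (λ w → f v w)) ≈ ∑ ℝ (λ w → ∑ ℝ (λ v → f v w))
    ∑-swap f = ∑-comm (λ i j → f (V.element i) (W.element j))

    -- Conjugated by the two enumerations, `π` becomes a permutation of positions.
    ∑-reindex : (π : V ↔ W) (f : W → Carrier) → ∑ ℝ (f ∘ Inverse.to π) ≈ ∑ ℝ f
    ∑-reindex π f = begin-equality
      ∑ ℝ (f ∘ Inverse.to π)
        ≈⟨ sum-cong-≋ (λ i → reflexive (≡.cong f (≡.sym (Inverse.strictlyInverseʳ W.enum (Inverse.to π (V.element i)))))) ⟩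
      sum (λ i → f (W.element (Inverse.to W.enum (Inverse.to π (V.element i)))))
        ≈⟨ sum-permute (f ∘ W.element) (W.enum ↔-∘ (π ↔-∘ ↔-sym V.enum)) ⟨
      ∑ ℝ f ∎

    ∑-× : (f : V × W → Carrier) → ∑ ℝ f ≈ ∑ ℝ (λ v → ∑ ℝ (λ w → f (v , w)))
    ∑-× f = sum-remQuot V.size W.size (λ (i , j) → f (V.element i , W.element j))

  ∑-Sign : (f : Sign → Carrier) → ∑ ℝ f ≈ f Sign.+ + f Sign.-
  ∑-Sign f = +-congˡ (+-identityʳ _)

-- Compactness without choice, and limits at a linear rate.

module Compactness (ℝ : CompleteOrderedField) where
  open OrderedField ℝ
  open Sums ℝ
  open SemiringSum semiring using (sum)

  Near : Carrier → Carrier → Carrier → Set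
  Near ε x a = x ≤ a + ε × a ≤ x + ε

  Near-mono : ∀ {ε δ x a} → ε ≤ δ → Near ε x a → Near δ x a
  Near-mono ε≤δ (x≤ , a≤) = ≤-trans x≤ (+-monoʳ-≤ _ ε≤δ) , ≤-trans a≤ (+-monoʳ-≤ _ ε≤δ)

  Monotone : {A : Set} → (Carrier → A → Set) → Set
  Monotone S = ∀ {ε δ x} → ε ≤ δ → S ε x → S δ x

  -- S ε is the set of ε-approximate solutions.  The negations keep the choice of
  -- one for each ε out of the argument.
  Approximable : {A : Set} → (Carrier → A → Set) → Set
  Approximable S = ∀ {ε} → 0# < ε → ¬ ¬ (∃[ x ] S ε x)

  -- The cluster value is the upper limit of φ over S ε as ε → 0.
  cluster : {A : Set} (S : Carrier → A → Set) → Monotone S → Approximable S →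
            (φ : A → Carrier) (lo hi : Carrier) →
            (∀ {ε x} → S ε x → lo ≤ φ x × φ x ≤ hi) →
            ∃[ a ] Approximable (λ ε x → S ε x × Near ε (φ x) a)
  cluster {A} S mono approx φ lo hi bounded = a , near
    where
    P : Carrier → Set
    P c = ∀ {ε} → 0# < ε → ¬ ¬ (∃[ x ] S ε x × c ≤ φ x)

    P-lo : P lo
    P-lo 0<ε none = approx 0<ε λ (x , s) → none (x , s , proj₁ (bounded s))

    P≤hi : hi isUpperBoundOf P
    P≤hi Pc = ≤-stable λ hi<c → Pc 0<1 λ (x , s , c≤φ) → hi<c (≤-trans c≤φ (proj₂ (bounded s)))

    least = supremum P (lo , P-lo) (hi , P≤hi)
    a = proj₁ least

    -- If no point of `S ε` had its value within `ε` of `a`, values above `a - ε` would have to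
    -- exceed `a + ε`, which would put `a + ε` into `P`, beyond its supremum. So `a - ε` would bound
    -- `P`, contradicting leastness.
    near : Approximable (λ ε x → S ε x × Near ε (φ x) a)
    near {ε} 0<ε none = x<x+ε {a + - ε} 0<ε (begin
      a + - ε + ε  ≈⟨ solve 2 (λ a e → a :+ :- e :+ e := a) refl a ε ⟩
      a            ≤⟨ proj₂ (proj₂ least) (a + - ε) (λ Pc → ≤-stable (no-larger Pc)) ⟩
      a + - ε      ∎)
      where
      no-larger : ∀ {c} → P c → ¬ (a + - ε < c)
      no-larger {c} Pc a-ε<c = x<x+ε 0<ε (proj₁ (proj₂ least) P-a+ε)
        where
        P-a+ε : P (a + ε)
        -- At the smaller of the two scales monotonicity puts the point into `S ε`, where `none`
        -- applies, and into `S δ`, where `none′` applies.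
        P-a+ε {δ} 0<δ none′ = [ (λ ε≤δ → at 0<ε ≤-refl ε≤δ) , (λ δ≤ε → at 0<δ δ≤ε ≤-refl) ]′ (total ε δ)
          where
          at : ∀ {η} → 0# < η → η ≤ ε → η ≤ δ → ⊥
          at 0<η η≤ε η≤δ = Pc 0<η λ (x , s , c≤φ) →
            none (x , mono η≤ε s , <⇒≤ (λ a+ε≤φ → none′ (x , mono η≤δ s , a+ε≤φ)) , (begin
              a                ≈⟨ solve 2 (λ a e → a := a :+ :- e :+ e) refl a ε ⟩
              a + - ε + ε      ≤⟨ +-mono-≤ (≤-trans (<⇒≤ a-ε<c) c≤φ) ≤-refl ⟩
              φ x + ε          ∎))

  -- Nearness to the first cluster value joins the approximation condition before the next
  -- coordinate is treated, so at each scale one point is near in all coordinates at once.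
  clusterᶠ : {A : Set} (S : Carrier → A → Set) → Monotone S → Approximable S →
             ∀ {k} (φ : Fin k → A → Carrier) (lo hi : Carrier) →
             (∀ {ε x} i → S ε x → lo ≤ φ i x × φ i x ≤ hi) →
             Σ[ a ∈ (Fin k → Carrier) ] Approximable (λ ε x → S ε x × (∀ i → Near ε (φ i x) (a i)))
  clusterᶠ S mono approx {zero} φ lo hi bounded =
    (λ ()) , λ 0<ε none → approx 0<ε λ (x , s) → none (x , s , λ ())
  clusterᶠ S mono approx {suc k} φ lo hi bounded =
    (λ { zero → a₀ ; (suc i) → as i }) , λ 0<ε none →
      as-near 0<ε λ (x , (s , n₀) , n) → none (x , s , λ { zero → n₀ ; (suc i) → n i })
    where
    head = cluster S mono approx (φ zero) lo hi (bounded zero)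
    a₀ = proj₁ head
    tail = clusterᶠ (λ ε x → S ε x × Near ε (φ zero x) a₀)
      (λ ε≤δ (s , n) → mono ε≤δ s , Near-mono ε≤δ n) (proj₂ head)
      (φ ∘ suc) lo hi (λ i (s , _) → bounded (suc i) s)
    as = proj₁ tail
    as-near = proj₂ tail

  cluster-family : {A I : Set} {{fin : Finite I}} (S : Carrier → A → Set) → Monotone S → Approximable S →
                   (φ : I → A → Carrier) (lo hi : Carrier) →
                   (∀ {ε x} i → S ε x → lo ≤ φ i x × φ i x ≤ hi) →
                   Σ[ a ∈ (I → Carrier) ] Approximable (λ ε x → S ε x × (∀ i → Near ε (φ i x) (a i)))
  cluster-family {{fin}} S mono approx φ lo hi bounded =
    a ∘ Inverse.to enum , λ 0<ε none → a-near 0<ε λ (x , s , n) →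
      none (x , s , λ i → ≡.subst (λ j → Near _ (φ j x) (a (Inverse.to enum i))) (element-to i)
                                  (n (Inverse.to enum i)))
    where
    open Finite fin using (enum; element)
    family = clusterᶠ S mono approx (φ ∘ element) lo hi (λ i → bounded (element i))
    a = proj₁ family
    a-near = proj₂ family

  -- Convergence at a linear rate is all that polynomial conditions of degree one need,
  -- and it is closed under finite sums without any ε-management.
  module Limits {A : Set} (S : Carrier → A → Set) where

    Lim : (A → Carrier) → Carrier → Set
    Lim f α = ∃[ C ] 0# ≤ C × (∀ {ε x} → S ε x → Near (C * ε) (f x) α)

    Lim-const : ∀ c → Lim (λ _ → c) c
    Lim-const c = 0# , ≤-refl , λ {ε} _ → c≤ ε , c≤ ε
      where
      c≤ : ∀ ε → c ≤ c + 0# * ε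
      c≤ ε = ≤-reflexive (solve 2 (λ c e → c := c :+ con (+ 0) :* e) refl c ε)

    Lim-near : ∀ {f α} → (∀ {ε x} → S ε x → Near ε (f x) α) → Lim f α
    Lim-near near = 1# , 0≤1 , λ s → Near-mono (≤-reflexive (sym (*-identityˡ _))) (near s)

    Lim-+ : ∀ {f g α β} → Lim f α → Lim g β → Lim (λ x → f x + g x) (α + β)
    Lim-+ {f} {g} {α} {β} (C , 0≤C , f→α) (D , 0≤D , g→β) = C + D , +-nonneg 0≤C 0≤D , λ s →
      add (proj₁ (f→α s)) (proj₁ (g→β s)) , add (proj₂ (f→α s)) (proj₂ (g→β s))
      where
      add : ∀ {a a′ b b′ ε} → a ≤ a′ + C * ε → b ≤ b′ + D * ε → a + b ≤ a′ + b′ + (C + D) * ε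
      add {a} {a′} {b} {b′} {ε} h k = begin
        a + b                          ≤⟨ +-mono-≤ h k ⟩
        a′ + C * ε + (b′ + D * ε)      ≈⟨ solve 5 (λ a b C D e → a :+ C :* e :+ (b :+ D :* e) := a :+ b :+ (C :+ D) :* e) refl a′ b′ C D ε ⟩
        a′ + b′ + (C + D) * ε          ∎

    Lim-cong : ∀ {f g α β} → (∀ x → f x ≈ g x) → α ≈ β → Lim f α → Lim g β
    Lim-cong f≈g α≈β (C , 0≤C , f→α) = C , 0≤C , λ {_} {x} s → let h , k = f→α s in
      ≤-trans (≤-reflexive (sym (f≈g x))) (≤-trans h (≤-reflexive (+-congʳ α≈β))) ,
      ≤-trans (≤-reflexive (sym α≈β)) (≤-trans k (≤-reflexive (+-congʳ (f≈g x))))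

    Lim-neg : ∀ {f α} → Lim f α → Lim (λ x → - f x) (- α)
    Lim-neg {f} {α} (C , 0≤C , f→α) = C , 0≤C , λ s → flip (proj₂ (f→α s)) , flip (proj₁ (f→α s))
      where
      flip : ∀ {a b e} → a ≤ b + e → - b ≤ - a + e
      flip {a} {b} {e} h = ≤-from (b + e + - a) (x≤y⇒0≤y-x h)
        (solve 3 (λ a b e → :- a :+ e :+ :- (:- b) := b :+ e :+ :- a) refl a b e)

    Lim-scale⁺ : ∀ {c f α} → 0# ≤ c → Lim f α → Lim (λ x → c * f x) (c * α)
    Lim-scale⁺ {c} 0≤c (C , 0≤C , f→α) = c * C , *-nonneg 0≤c 0≤C , λ s →
      mul (proj₁ (f→α s)) , mul (proj₂ (f→α s))
      where
      mul : ∀ {a b e} → a ≤ b + C * e → c * a ≤ c * b + c * C * e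
      mul {a} {b} {e} h = ≤-trans (*-monoˡ-≤ 0≤c h)
        (≤-reflexive (solve 4 (λ c b C e → c :* (b :+ C :* e) := c :* b :+ c :* C :* e) refl c b C e))

    Lim-scale : ∀ c {f α} → Lim f α → Lim (λ x → c * f x) (c * α)
    Lim-scale c {f} {α} l with total 0# c
    ... | inj₁ 0≤c = Lim-scale⁺ 0≤c l
    ... | inj₂ c≤0 = Lim-cong (λ _ → neg-neg _) (neg-neg _)
      (Lim-neg (Lim-scale⁺ (x≤y⇒0≤y-x c≤0) l))
      where
      neg-neg : ∀ a → - ((0# + - c) * a) ≈ c * a
      neg-neg = solve 2 (λ c a → :- ((con (+ 0) :+ :- c) :* a) := c :* a) refl c

    Lim-∑ : {I : Set} {{fin : Finite I}} {f : I → A → Carrier} {α : I → Carrier} →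
            (∀ i → Lim (f i) (α i)) → Lim (λ x → ∑ ℝ (λ i → f i x)) (∑ ℝ α)
    Lim-∑ {{fin}} {f} {α} l = Lim-sum (λ i → f (element i)) (λ i → α (element i)) (λ i → l (element i))
      where
      open Finite fin using (element)
      Lim-sum : ∀ {n} (f : Fin n → A → Carrier) (α : Fin n → Carrier) →
                (∀ i → Lim (f i) (α i)) → Lim (λ x → sum (λ i → f i x)) (sum α)
      Lim-sum {zero}  f α l = Lim-const 0#
      Lim-sum {suc n} f α l = Lim-+ (l zero) (Lim-sum (f ∘ suc) (α ∘ suc) (l ∘ suc))

    module _ (approx : Approximable S) where

      -- The slack `ε` accommodates near-optimality, which approximants satisfy only up to `ε`. All
      -- errors add up to a multiple of `ε`, and the conclusion is stable, so a doubly negated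
      -- approximant is enough.
      lim-mono : ∀ {f g α β} → Lim f α → Lim g β → (∀ {ε x} → 0# < ε → S ε x → f x ≤ g x + ε) → α ≤ β
      lim-mono {f} {g} {α} {β} (C , 0≤C , f→α) (D , 0≤D , g→β) f≤g =
        ≤-archimedean (C + 1# + D) (+-nonneg (+-nonneg 0≤C 0≤1) 0≤D) λ {ε} 0<ε →
          ≤-stable λ ¬h → approx 0<ε λ (x , s) → ¬h (begin
            α                            ≤⟨ proj₂ (f→α s) ⟩
            f x + C * ε                  ≤⟨ +-mono-≤ (f≤g 0<ε s) ≤-refl ⟩
            g x + ε + C * ε              ≤⟨ +-mono-≤ (+-mono-≤ (proj₁ (g→β s)) ≤-refl) ≤-refl ⟩
            β + D * ε + ε + C * ε        ≈⟨ solve 4 (λ b C D e → b :+ D :* e :+ e :+ C :* e := b :+ (C :+ con (+ 1) :+ D) :* e) refl β C D ε ⟩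
            β + (C + 1# + D) * ε         ∎)

      lim-≤ : ∀ {f g α β} → Lim f α → Lim g β → (∀ {ε x} → S ε x → f x ≤ g x) → α ≤ β
      lim-≤ f→α g→β f≤g = lim-mono f→α g→β λ {ε} 0<ε s → ≤-trans (f≤g s)
        (≤-trans (≤-reflexive (sym (+-identityʳ _))) (+-monoʳ-≤ _ (<⇒≤ 0<ε)))

      lim-≈ : ∀ {f g α β} → Lim f α → Lim g β → (∀ {ε x} → S ε x → f x ≈ g x) → α ≈ β
      lim-≈ f→α g→β f≈g = antisym (lim-≤ f→α g→β (≤-reflexive ∘ f≈g)) (lim-≤ g→β f→α (≤-reflexive ∘ sym ∘ f≈g))

-- Bilinear forms and semidefinite matrices.

module Forms (ℝ : CompleteOrderedField) where
  open OrderedField ℝ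
  open Sums ℝ

  module _ {W : Set} {{fin : Finite W}} where

    form : Matrix ℝ W → Vector ℝ W → Vector ℝ W → Carrier
    form Z x y = ∑ ℝ (λ u → ∑ ℝ (λ v → x u * Z u v * y v))

    ∑∑-+ : (f g : W → W → Carrier) → ∑ ℝ (λ u → ∑ ℝ (λ v → f u v + g u v)) ≈
           ∑ ℝ (λ u → ∑ ℝ (f u)) + ∑ ℝ (λ u → ∑ ℝ (g u))
    ∑∑-+ f g = trans (∑-cong λ u → ∑-+ (f u) (g u)) (∑-+ (λ u → ∑ ℝ (f u)) (λ u → ∑ ℝ (g u)))

    ∑∑-* : ∀ c (f : W → W → Carrier) →
           ∑ ℝ (λ u → ∑ ℝ (λ v → c * f u v)) ≈ c * ∑ ℝ (λ u → ∑ ℝ (f u))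
    ∑∑-* c f = trans (∑-cong λ u → ∑-* c (f u)) (∑-* c (λ u → ∑ ℝ (f u)))

    form-sym : ∀ {Z} → IsSymmetric ℝ Z → ∀ x y → form Z x y ≈ form Z y x
    form-sym {Z} sym-Z x y = trans (∑-swap (λ u v → x u * Z u v * y v)) (∑-cong λ v → ∑-cong λ u → begin-equality
      x u * Z u v * y v  ≈⟨ *-congʳ (*-congˡ (sym-Z u v)) ⟩
      x u * Z v u * y v  ≈⟨ solve 3 (λ x z y → x :* z :* y := y :* z :* x) refl (x u) (Z v u) (y v) ⟩
      y v * Z v u * x u  ∎)

    form-expand : ∀ {Z} → IsSymmetric ℝ Z → ∀ x c y →
                  form Z (λ u → x u + c * y u) (λ u → x u + c * y u) ≈
                  form Z x x + (1# + 1#) * c * form Z x y + c * c * form Z y y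
    form-expand {Z} sym-Z x c y = begin-equality
      form Z (λ u → x u + c * y u) (λ u → x u + c * y u)
        ≈⟨ ∑-cong (λ u → ∑-cong λ v → solve 6 (λ c x y z x′ y′ →
             (x :+ c :* y) :* z :* (x′ :+ c :* y′) :=
             (x :* z :* x′ :+ c :* (x :* z :* y′ :+ y :* z :* x′)) :+ c :* c :* (y :* z :* y′))
             refl c (x u) (y u) (Z u v) (x v) (y v)) ⟩
      ∑ ℝ (λ u → ∑ ℝ (λ v → (a u v + c * (b u v + b′ u v)) + c * c * d u v))
        ≈⟨ trans (∑∑-+ (λ u v → a u v + c * (b u v + b′ u v)) (λ u v → c * c * d u v)) (+-cong
             (trans (∑∑-+ a (λ u v → c * (b u v + b′ u v)))
               (+-congˡ (trans (∑∑-* c (λ u v → b u v + b′ u v)) (*-congˡ (∑∑-+ b b′)))))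
             (∑∑-* (c * c) d)) ⟩
      form Z x x + c * (form Z x y + form Z y x) + c * c * form Z y y
        ≈⟨ +-congʳ (+-congˡ (*-congˡ (+-congˡ (form-sym sym-Z y x)))) ⟩
      form Z x x + c * (form Z x y + form Z x y) + c * c * form Z y y
        ≈⟨ solve 4 (λ c p q r → p :+ c :* (q :+ q) :+ c :* c :* r := p :+ (con (+ 1) :+ con (+ 1)) :* c :* q :+ c :* c :* r)
             refl c (form Z x x) (form Z x y) (form Z y y) ⟩
      form Z x x + (1# + 1#) * c * form Z x y + c * c * form Z y y ∎
      where
      a b b′ d : W → W → Carrier
      a  u v = x u * Z u v * x v
      b  u v = x u * Z u v * y v
      b′ u v = y u * Z u v * x v
      d  u v = y u * Z u v * y v

    δ : W → Vector ℝ W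
    δ u v = if does (Finite._≟_ fin v u) then 1# else 0#

    δ-refl : ∀ u → δ u u ≡ 1#
    δ-refl u rewrite dec-true (Finite._≟_ fin u u) ≡.refl = ≡.refl

    δ-≢ : ∀ {u v} → v ≢ u → δ u v ≡ 0#
    δ-≢ {u} {v} v≢u rewrite dec-false (Finite._≟_ fin v u) v≢u = ≡.refl

    ∑-δ : ∀ u (f : Vector ℝ W) → ∑ ℝ (λ v → f v * δ u v) ≈ f u
    ∑-δ u f = trans (∑-single _ u λ v v≢u → trans (*-congˡ (reflexive (δ-≢ v≢u))) (zeroʳ _))
                    (trans (*-congˡ (reflexive (δ-refl u))) (*-identityʳ _))

    form-δʳ : ∀ Z x v → form Z x (δ v) ≈ ∑ ℝ (λ u → x u * Z u v)
    form-δʳ Z x v = ∑-cong λ u → ∑-δ v (λ v → x u * Z u v)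

    form-δδ : ∀ Z u v → form Z (δ u) (δ v) ≈ Z u v
    form-δδ Z u v = trans (form-δʳ Z (δ u) v) (trans (∑-cong λ w → *-comm (δ u w) (Z w v)) (∑-δ u (λ w → Z w v)))

    𝟙 : Vector ℝ W
    𝟙 _ = 1#

    rowSum : Matrix ℝ W → Vector ℝ W
    rowSum Z u = ∑ ℝ (Z u)

    ⟨J,⟩≈∑-rowSum : ∀ Z → ⟨_,_⟩ ℝ (J ℝ) Z ≈ ∑ ℝ (rowSum Z)
    ⟨J,⟩≈∑-rowSum Z = ∑-cong λ u → ∑-cong λ v → *-identityˡ (Z u v)

    form-𝟙ʳ : ∀ Z x → form Z x 𝟙 ≈ ∑ ℝ (λ u → x u * rowSum Z u)
    form-𝟙ʳ Z x = ∑-cong λ u → trans (∑-cong λ v → *-identityʳ (x u * Z u v)) (∑-* (x u) (Z u))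

    form-𝟙𝟙 : ∀ Z → form Z 𝟙 𝟙 ≈ ⟨_,_⟩ ℝ (J ℝ) Z
    form-𝟙𝟙 Z = ∑-cong λ u → ∑-cong λ v → *-identityʳ (1# * Z u v)

    ⟨J,⟩-nonneg : ∀ {Z} → PSD ℝ Z → 0# ≤ ⟨_,_⟩ ℝ (J ℝ) Z
    ⟨J,⟩-nonneg {Z} psd = ≤-trans (proj₂ psd 𝟙) (≤-reflexive (form-𝟙𝟙 Z))

    diagonal-nonneg : ∀ {Z} → PSD ℝ Z → ∀ u → 0# ≤ Z u u
    diagonal-nonneg {Z} psd u = ≤-trans (proj₂ psd (δ u)) (≤-reflexive (form-δδ Z u u))

    -- The form at `δ u + c δ v`; the values c = 1 and c = -1 bound the off-diagonal entries by the
    -- diagonal ones.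
    minor-nonneg : ∀ {Z} → PSD ℝ Z → ∀ u v c → 0# ≤ Z u u + (1# + 1#) * c * Z u v + c * c * Z v v
    minor-nonneg {Z} psd u v c = ≤-trans (proj₂ psd (λ w → δ u w + c * δ v w)) (≤-reflexive
      (trans (form-expand (proj₁ psd) (δ u) c (δ v))
        (+-cong (+-cong (form-δδ Z u u) (*-congˡ (form-δδ Z u v))) (*-congˡ (form-δδ Z v v)))))

    -- Along `𝟙 + c δ u` the quadratic term vanishes and the form is t + 2cw. An affine function of
    -- c that never becomes negative has slope zero.
    rowSum-vanishes : ∀ {Z} → PSD ℝ Z → ∀ u → Z u u ≈ 0# → rowSum Z u ≈ 0#
    rowSum-vanishes {Z} psd u Zuu≈0 = decidable-stable (w ≈? 0#) λ w≉0 →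
      let i , wi≈1 = inverse w w≉0
          -- For c = -(t + 1)/w the form equals -t - 2, so the form plus t + 1 is -1 although each
          -- summand is nonnegative.
          c = - (t + 1#) * i
      in 0<1 (≤-from (form Z (λ v → 𝟙 v + c * δ u v) (λ v → 𝟙 v + c * δ u v) + t + 1#)
        (+-nonneg (+-nonneg (proj₂ psd (λ v → 𝟙 v + c * δ u v)) (⟨J,⟩-nonneg psd)) 0≤1)
        (begin-equality
          0# + - 1#
            ≈⟨ solve 1 (λ t → con (+ 0) :+ :- con (+ 1) := t :+ (con (+ 1) :+ con (+ 1)) :* (:- (t :+ con (+ 1))) :* con (+ 1) :+ t :+ con (+ 1)) refl t ⟩
          t + (1# + 1#) * (- (t + 1#)) * 1# + t + 1#
            ≈⟨ +-congʳ (+-congʳ (+-congˡ (*-congˡ wi≈1))) ⟨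
          t + (1# + 1#) * (- (t + 1#)) * (w * i) + t + 1#
            ≈⟨ solve 3 (λ t w i → t :+ (con (+ 1) :+ con (+ 1)) :* (:- (t :+ con (+ 1))) :* (w :* i) :+ t :+ con (+ 1) :=
                 t :+ (con (+ 1) :+ con (+ 1)) :* ((:- (t :+ con (+ 1))) :* i) :* w :+ ((:- (t :+ con (+ 1))) :* i) :* ((:- (t :+ con (+ 1))) :* i) :* con (+ 0) :+ t :+ con (+ 1))
                 refl t w i ⟩
          t + (1# + 1#) * c * w + c * c * 0# + t + 1#
            ≈⟨ +-congʳ (+-congʳ (at c)) ⟨
          form Z (λ v → 𝟙 v + c * δ u v) (λ v → 𝟙 v + c * δ u v) + t + 1# ∎))
      where
      t = ⟨_,_⟩ ℝ (J ℝ) Z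
      w = rowSum Z u
      at : ∀ c → form Z (λ v → 𝟙 v + c * δ u v) (λ v → 𝟙 v + c * δ u v) ≈ t + (1# + 1#) * c * w + c * c * 0#
      at c = trans (form-expand (proj₁ psd) 𝟙 c (δ u)) (+-cong
        (+-cong (form-𝟙𝟙 Z) (*-congˡ (trans (form-δʳ Z 𝟙 u) (∑-cong λ v → trans (*-identityˡ (Z v u)) (proj₁ psd v u)))))
        (*-congˡ (trans (form-δδ Z u u) Zuu≈0)))

    form-bordered : ∀ x X (z : Vector ℝ (⊤ ⊎ W)) → let z₀ = z (inj₁ tt) ; ζ = z ∘ inj₂ in
      ∑ ℝ (λ u → ∑ ℝ (λ v → z u * bordered ℝ x X u v * z v)) ≈
      z₀ * z₀ + (1# + 1#) * z₀ * ∑ ℝ (λ v → ζ v * x v) + form X ζ ζ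
    form-bordered x X z = begin-equality
      -- The enumeration of `⊤ ⊎ W` starts with the border, so the double sum unfolds into its four
      -- blocks by computation.
      z₀ * 1# * z₀ + ∑ ℝ (λ v → z₀ * x v * ζ v) + ∑ ℝ (λ u → ζ u * x u * z₀ + ∑ ℝ (λ v → ζ u * X u v * ζ v))
        ≈⟨ +-cong (+-congˡ (linear λ v → solve 3 (λ a b c → a :* b :* c := a :* (c :* b)) refl z₀ (x v) (ζ v)))
                  (trans (∑-+ (λ u → ζ u * x u * z₀) (λ u → ∑ ℝ (λ v → ζ u * X u v * ζ v)))
                    (+-congʳ (linear λ v → *-comm (ζ v * x v) z₀))) ⟩
      z₀ * 1# * z₀ + z₀ * s + (z₀ * s + form X ζ ζ)
        ≈⟨ solve 3 (λ z s q → z :* con (+ 1) :* z :+ z :* s :+ (z :* s :+ q) := z :* z :+ (con (+ 1) :+ con (+ 1)) :* z :* s :+ q) refl z₀ s (form X ζ ζ) ⟩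
      z₀ * z₀ + (1# + 1#) * z₀ * s + form X ζ ζ ∎
      where
      z₀ = z (inj₁ tt)
      ζ = z ∘ inj₂
      s = ∑ ℝ (λ v → ζ v * x v)
      linear : ∀ {f : Vector ℝ W} → (∀ v → f v ≈ z₀ * (ζ v * x v)) → ∑ ℝ f ≈ z₀ * s
      linear h = trans (∑-cong h) (∑-* z₀ (λ v → ζ v * x v))

    bordered-symmetric : ∀ {x} {X : Matrix ℝ W} → IsSymmetric ℝ X → IsSymmetric ℝ (bordered ℝ x X)
    bordered-symmetric sym-X (inj₁ _) (inj₁ _) = refl
    bordered-symmetric sym-X (inj₁ _) (inj₂ _) = refl
    bordered-symmetric sym-X (inj₂ _) (inj₁ _) = refl
    bordered-symmetric sym-X (inj₂ u) (inj₂ v) = sym-X u v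

-- The two semidefinite programs and the attainment of their maxima.

module Theta (ℝ : CompleteOrderedField) where
  open OrderedField ℝ
  open Sums ℝ
  open Compactness ℝ
  open Forms ℝ

  module _ {W : Set} {{fin : Finite W}} where

    term≤∑ : {f : Vector ℝ W} → (∀ v → 0# ≤ f v) → ∀ u → f u ≤ ∑ ℝ f
    term≤∑ {f} 0≤f u = ≤-trans (≤-reflexive (sym (∑-δ u f))) (∑-mono f*δ≤f)
      where
      f*δ≤f : ∀ v → f v * δ u v ≤ f v
      f*δ≤f v with Finite._≟_ fin v u
      ... | yes ≡.refl = ≤-reflexive (trans (*-congˡ (reflexive (δ-refl v))) (*-identityʳ _))
      ... | no  v≢u    = ≤-trans (≤-reflexive (trans (*-congˡ (reflexive (δ-≢ v≢u))) (zeroʳ _))) (0≤f v)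

    outer : Vector ℝ W → Matrix ℝ W
    outer x u v = x u * x v

    outer-psd : ∀ x → PSD ℝ (outer x)
    outer-psd x = (λ u v → *-comm (x u) (x v)) , λ z → ≤-trans (x*x≥0 (∑ ℝ (λ u → z u * x u))) (≤-reflexive (begin-equality
      s z * s z                                     ≈⟨ ∑-* (s z) (λ u → z u * x u) ⟨
      ∑ ℝ (λ u → s z * (z u * x u))                 ≈⟨ ∑-cong (λ u → *-comm (s z) (z u * x u)) ⟩
      ∑ ℝ (λ u → z u * x u * s z)                   ≈⟨ ∑-cong (λ u → sym (∑-* (z u * x u) (λ v → z v * x v))) ⟩
      ∑ ℝ (λ u → ∑ ℝ (λ v → z u * x u * (z v * x v))) ≈⟨ ∑-cong (λ u → ∑-cong λ v →
        solve 4 (λ a b c d → a :* b :* (c :* d) := a :* (b :* d) :* c) refl (z u) (x u) (z v) (x v)) ⟩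
      form (outer x) z z ∎))
      where
      s : Vector ℝ W → Carrier
      s z = ∑ ℝ (λ u → z u * x u)

    ⟨J,outer-δ⟩ : ∀ w → ⟨_,_⟩ ℝ (J ℝ) (outer (δ w)) ≈ 1#
    ⟨J,outer-δ⟩ w = begin-equality
      ⟨_,_⟩ ℝ (J ℝ) (outer (δ w))       ≈⟨ ∑-cong (λ u → ∑-cong λ v → *-identityˡ (δ w u * δ w v)) ⟩
      ∑ ℝ (λ u → ∑ ℝ (λ v → δ w u * δ w v)) ≈⟨ ∑-cong (λ u → ∑-δ w (λ _ → δ w u)) ⟩
      ∑ ℝ (δ w)                         ≈⟨ ∑-cong (λ u → sym (*-identityˡ (δ w u))) ⟩
      ∑ ℝ (λ u → 1# * δ w u)            ≈⟨ ∑-δ w 𝟙 ⟩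
      1#                                ∎

    module _ (H : SimpleGraph W) where
      open SimpleGraph H using (Adj; irrefl)

      -- Diagonal entries are nonnegative with sum 1, hence at most 1, and Z_uu + Z_vv ± 2 Z_uv ≥ 0.
      -- This is the box in which cluster values are taken.
      entry-bounded : ∀ {Z} → ThetaFeasible ℝ H Z → ∀ u v → - 1# ≤ Z u v × Z u v ≤ 1#
      entry-bounded {Z} (psd , tr≈1 , _) u v =
        double-cancel-≤ (≤-from (d + (1# + - Z u u) + (1# + - Z v v)) (+-nonneg (+-nonneg (minor-nonneg psd u v 1#) (slack u)) (slack v))
          (solve 3 (λ a b c → b :+ b :+ :- (:- con (+ 1) :+ :- con (+ 1)) :=
            a :+ (con (+ 1) :+ con (+ 1)) :* con (+ 1) :* b :+ con (+ 1) :* con (+ 1) :* c :+ (con (+ 1) :+ :- a) :+ (con (+ 1) :+ :- c))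
            refl (Z u u) (Z u v) (Z v v))) ,
        double-cancel-≤ (≤-from (d′ + (1# + - Z u u) + (1# + - Z v v)) (+-nonneg (+-nonneg (minor-nonneg psd u v (- 1#)) (slack u)) (slack v))
          (solve 3 (λ a b c → con (+ 1) :+ con (+ 1) :+ :- (b :+ b) :=
            a :+ (con (+ 1) :+ con (+ 1)) :* (:- con (+ 1)) :* b :+ (:- con (+ 1)) :* (:- con (+ 1)) :* c :+ (con (+ 1) :+ :- a) :+ (con (+ 1) :+ :- c))
            refl (Z u u) (Z u v) (Z v v)))
        where
        d = Z u u + (1# + 1#) * 1# * Z u v + 1# * 1# * Z v v
        d′ = Z u u + (1# + 1#) * (- 1#) * Z u v + (- 1#) * (- 1#) * Z v v
        slack : ∀ w → 0# ≤ 1# + - Z w w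
        slack w = x≤y⇒0≤y-x (≤-trans (term≤∑ (diagonal-nonneg psd) w) (≤-reflexive tr≈1))

      ⟨J,⟩-bounded : ∀ {Z} → ThetaFeasible ℝ H Z → ⟨_,_⟩ ℝ (J ℝ) Z ≤ ∑ ℝ (λ (u : W) → ∑ ℝ (λ (v : W) → 1#))
      ⟨J,⟩-bounded {Z} feasible = ∑-mono λ u → ∑-mono λ v →
        ≤-trans (≤-reflexive (*-identityˡ (Z u v))) (proj₂ (entry-bounded feasible u v))

      δ-feasible : ∀ w → ThetaFeasible ℝ H (outer (δ w))
      δ-feasible w = outer-psd (δ w) , trans (∑-δ w (δ w)) (reflexive (δ-refl w)) , vanishes
        where
        vanishes : ∀ {u v} → Adj u v → δ w u * δ w v ≈ 0#
        vanishes {u} {v} e with Finite._≟_ fin u w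
        ... | no  u≢w    = trans (*-congʳ (reflexive (δ-≢ u≢w))) (zeroˡ _)
        ... | yes ≡.refl = trans (*-congˡ (reflexive (δ-≢ λ v≡u → irrefl (≡.sym v≡u) e))) (zeroʳ _)

      TH-form-nonneg : ∀ {x} ((X , _) : TH ℝ H x) → ∀ z₀ ζ →
                       0# ≤ z₀ * z₀ + (1# + 1#) * z₀ * ∑ ℝ (λ v → ζ v * x v) + form X ζ ζ
      TH-form-nonneg {x} (X , _ , (_ , psd) , _) z₀ ζ =
        ≤-trans (psd z) (≤-reflexive (form-bordered x X z))
        where
        z : Vector ℝ (⊤ ⊎ W)
        z (inj₁ _) = z₀
        z (inj₂ v) = ζ v

      TH⇒theta : ∀ {x} → TH ℝ H x → 0# < ∑ ℝ x → ∃[ Z ] ThetaFeasible ℝ H Z × ∑ ℝ x ≤ ⟨_,_⟩ ℝ (J ℝ) Z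
      TH⇒theta {x} th@(X , sym-X , _ , diag , vanish) 0<s =
        Z , (((λ u v → *-congˡ (sym-X u v)) , psd) ,
        (begin-equality
          tr ℝ Z                ≈⟨ ∑-* i (λ v → X v v) ⟩
          i * tr ℝ X            ≈⟨ *-congˡ (∑-cong diag) ⟩
          i * s                 ≈⟨ trans (*-comm i s) si≈1 ⟩
          1#                    ∎) ,
        (λ e → trans (*-congˡ (vanish e)) (zeroʳ i))) ,
        (begin
          s                     ≈⟨ *-identityˡ s ⟨
          1# * s                ≈⟨ *-congʳ si≈1 ⟨
          s * i * s             ≈⟨ solve 2 (λ s i → s :* i :* s := i :* (s :* s)) refl s i ⟩
          i * (s * s)           ≤⟨ *-monoˡ-≤ (<⇒≤ 0<i) s²≤ ⟩
          i * form X 𝟙 𝟙        ≈⟨ form-Z 𝟙 ⟨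
          form Z 𝟙 𝟙            ≈⟨ form-𝟙𝟙 Z ⟩
          ⟨_,_⟩ ℝ (J ℝ) Z       ∎)
        where
        s = ∑ ℝ x
        i = proj₁ (recip 0<s)
        si≈1 = proj₁ (proj₂ (recip 0<s))
        0<i = proj₂ (proj₂ (recip 0<s))
        Z : Matrix ℝ W
        Z u v = i * X u v
        form-Z : ∀ z → form Z z z ≈ i * form X z z
        form-Z z = trans (∑-cong λ u → ∑-cong λ v →
          solve 4 (λ a i b c → a :* (i :* b) :* c := i :* (a :* b :* c)) refl (z u) i (X u v) (z v))
          (∑∑-* i (λ u v → z u * X u v * z v))
        psd : ∀ z → 0# ≤ form Z z z
        psd z = begin
          0#              ≤⟨ *-nonneg (<⇒≤ 0<i) (TH-form-nonneg th 0# z) ⟩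
          i * (0# * 0# + (1# + 1#) * 0# * σ + form X z z)
            ≈⟨ solve 3 (λ i a b → i :* (con (+ 0) :* con (+ 0) :+ (con (+ 1) :+ con (+ 1)) :* con (+ 0) :* a :+ b) := i :* b) refl i σ (form X z z) ⟩
          i * form X z z  ≈⟨ form-Z z ⟨
          form Z z z      ∎
          where σ = ∑ ℝ (λ v → z v * x v)
        s²≤ : s * s ≤ form X 𝟙 𝟙
        -- At the test vector with border coordinate -s and all others 1, the bordered form is ⟨J,
        -- X⟩ - s².
        s²≤ = ≤-from _ (TH-form-nonneg th (- s) 𝟙) (begin-equality
          form X 𝟙 𝟙 + - (s * s)
            ≈⟨ solve 2 (λ s q → q :+ :- (s :* s) := (:- s) :* (:- s) :+ (con (+ 1) :+ con (+ 1)) :* (:- s) :* s :+ q) refl s (form X 𝟙 𝟙) ⟩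
          (- s) * (- s) + (1# + 1#) * (- s) * s + form X 𝟙 𝟙
            ≈⟨ +-congʳ (+-congˡ (*-congˡ (∑-cong λ v → sym (*-identityˡ (x v))))) ⟩
          (- s) * (- s) + (1# + 1#) * (- s) * ∑ ℝ (λ v → 1# * x v) + form X 𝟙 𝟙 ∎)

      -- With Z the Gram matrix of vectors zᵤ and c their sum, the diagonal scaling by
      -- dᵤ = ⟨zᵤ, c⟩ / |zᵤ|² makes the bordered matrix the Gram matrix of c and the dᵤ zᵤ, up to
      -- the factor |c|² = ⟨J, Z⟩.  Cauchy–Schwarz is the nonnegativity of Σ (dᵤ − t)² Zᵤᵤ.
      theta⇒TH : ∀ {Z} → ThetaFeasible ℝ H Z → 0# < ⟨_,_⟩ ℝ (J ℝ) Z → ∃[ x ] TH ℝ H x × ⟨_,_⟩ ℝ (J ℝ) Z ≤ ∑ ℝ x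
      theta⇒TH {Z} (psd@(sym-Z , Z≥0) , tr≈1 , vanish) 0<t =
        x , (X , sym-X , (bordered-symmetric sym-X , bordered≥0) , diag , X-vanish) , t≤∑x
        where
        t = ⟨_,_⟩ ℝ (J ℝ) Z
        w = rowSum Z
        i = proj₁ (recip 0<t)
        ti≈1 = proj₁ (proj₂ (recip 0<t))
        0<i = proj₂ (proj₂ (recip 0<t))
        ratio : ∀ u → ∃[ d ] d * Z u u ≈ w u
        ratio u with Z u u ≈? 0#
        -- If Z_uu = 0 then w_u = 0 too, so any ratio satisfies the equation; 0 is taken.
        ... | yes Z≈0 = 0# , trans (zeroˡ _) (sym (rowSum-vanishes psd u Z≈0))
        ... | no  Z≉0 = let r , Zr≈1 = inverse (Z u u) Z≉0 in w u * r , (begin-equality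
          w u * r * Z u u   ≈⟨ solve 3 (λ w r z → w :* r :* z := w :* (z :* r)) refl (w u) r (Z u u) ⟩
          w u * (Z u u * r) ≈⟨ *-congˡ Zr≈1 ⟩
          w u * 1#          ≈⟨ *-identityʳ _ ⟩
          w u               ∎)
        d : Vector ℝ W
        d u = proj₁ (ratio u)
        dZ≈w : ∀ u → d u * Z u u ≈ w u
        dZ≈w u = proj₂ (ratio u)
        x : Vector ℝ W
        x u = i * (d u * w u)
        X : Matrix ℝ W
        X u v = i * (d u * Z u v * d v)
        sym-X : IsSymmetric ℝ X
        sym-X u v = *-congˡ (trans (*-congʳ (*-congˡ (sym-Z u v)))
          (solve 3 (λ a b c → a :* b :* c := c :* b :* a) refl (d u) (Z v u) (d v)))
        diag : ∀ v → X v v ≈ x v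
        diag v = *-congˡ (trans (*-congʳ (dZ≈w v)) (*-comm (w v) (d v)))
        X-vanish : ∀ {u v} → Adj u v → X u v ≈ 0#
        X-vanish {u} {v} e = trans (*-congˡ (*-congʳ (*-congˡ (vanish e))))
          (solve 3 (λ i a b → i :* (a :* con (+ 0) :* b) := con (+ 0)) refl i (d u) (d v))
        bordered≥0 : ∀ z → 0# ≤ ∑ ℝ (λ u → ∑ ℝ (λ v → z u * bordered ℝ x X u v * z v))
        bordered≥0 z = begin
          -- The bordered form at (z₀, ζ) is 1/t times the form of `Z` at Dζ + z₀𝟙.
          0# ≤⟨ *-nonneg (<⇒≤ 0<i) (Z≥0 (λ u → a u + z₀ * 𝟙 u)) ⟩
          i * form Z (λ u → a u + z₀ * 𝟙 u) (λ u → a u + z₀ * 𝟙 u)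
            ≈⟨ *-congˡ (trans (form-expand sym-Z a z₀ 𝟙) (+-cong (+-congˡ (*-congˡ (form-𝟙ʳ Z a))) (*-congˡ (form-𝟙𝟙 Z)))) ⟩
          i * (form Z a a + (1# + 1#) * z₀ * ∑ ℝ (λ u → a u * w u) + z₀ * z₀ * t)
            ≈⟨ solve 5 (λ i q z s t → i :* (q :+ (con (+ 1) :+ con (+ 1)) :* z :* s :+ z :* z :* t) :=
                 z :* z :* (t :* i) :+ (con (+ 1) :+ con (+ 1)) :* z :* (i :* s) :+ i :* q)
                 refl i (form Z a a) z₀ (∑ ℝ (λ u → a u * w u)) t ⟩
          z₀ * z₀ * (t * i) + (1# + 1#) * z₀ * (i * ∑ ℝ (λ u → a u * w u)) + i * form Z a a
            ≈⟨ +-cong (+-cong (trans (*-congˡ ti≈1) (*-identityʳ _)) (*-congˡ (sym linear))) (sym quadratic) ⟩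
          z₀ * z₀ + (1# + 1#) * z₀ * ∑ ℝ (λ v → ζ v * x v) + form X ζ ζ
            ≈⟨ form-bordered x X z ⟨
          ∑ ℝ (λ u → ∑ ℝ (λ v → z u * bordered ℝ x X u v * z v)) ∎
          where
          z₀ = z (inj₁ tt)
          ζ = z ∘ inj₂
          a : Vector ℝ W
          a u = ζ u * d u
          linear : ∑ ℝ (λ v → ζ v * x v) ≈ i * ∑ ℝ (λ u → a u * w u)
          linear = trans (∑-cong λ v → solve 4 (λ z i d w → z :* (i :* (d :* w)) := i :* (z :* d :* w)) refl (ζ v) i (d v) (w v))
                         (∑-* i (λ u → a u * w u))
          quadratic : form X ζ ζ ≈ i * form Z a a
          quadratic = trans (∑-cong λ u → ∑-cong λ v →
              solve 6 (λ y d i b d′ y′ → y :* (i :* (d :* b :* d′)) :* y′ := i :* (y :* d :* b :* (y′ :* d′)))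
                refl (ζ u) (d u) i (Z u v) (d v) (ζ v))
            (∑∑-* i (λ u v → a u * Z u v * a v))
        Σdw = ∑ ℝ (λ u → d u * w u)
        t²≤ : t * t ≤ Σdw
        t²≤ = ≤-from (∑ ℝ (λ u → (d u + - t) * (d u + - t) * Z u u))
          (∑-nonneg λ u → *-nonneg (x*x≥0 (d u + - t)) (diagonal-nonneg psd u))
          (sym (begin-equality
            ∑ ℝ (λ u → (d u + - t) * (d u + - t) * Z u u)
              ≈⟨ ∑-cong (λ u → solve 3 (λ d t z → (d :+ :- t) :* (d :+ :- t) :* z :=
                   d :* (d :* z) :+ ((:- (t :+ t)) :* (d :* z) :+ t :* t :* z)) refl (d u) t (Z u u)) ⟩
            ∑ ℝ (λ u → d u * (d u * Z u u) + (- (t + t) * (d u * Z u u) + t * t * Z u u))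
              ≈⟨ ∑-cong (λ u → +-cong (*-congˡ {d u} (dZ≈w u)) (+-congʳ {t * t * Z u u} (*-congˡ {(- (t + t))} (dZ≈w u)))) ⟩
            ∑ ℝ (λ u → d u * w u + (- (t + t) * w u + t * t * Z u u))
              ≈⟨ trans (∑-+ (λ u → d u * w u) (λ u → - (t + t) * w u + t * t * Z u u)) (+-congˡ
                   (trans (∑-+ (λ u → - (t + t) * w u) (λ u → t * t * Z u u))
                     (+-cong (∑-* (- (t + t)) w) (∑-* (t * t) (λ u → Z u u))))) ⟩
            Σdw + (- (t + t) * ∑ ℝ w + t * t * tr ℝ Z)
              ≈⟨ +-congˡ (+-cong (*-congˡ (sym (⟨J,⟩≈∑-rowSum Z))) (*-congˡ tr≈1)) ⟩
            Σdw + (- (t + t) * t + t * t * 1#)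
              ≈⟨ solve 2 (λ s t → s :+ ((:- (t :+ t)) :* t :+ t :* t :* con (+ 1)) := s :+ :- (t :* t)) refl Σdw t ⟩
            Σdw + - (t * t) ∎))
        t≤∑x : t ≤ ∑ ℝ x
        t≤∑x = begin
          t            ≈⟨ *-identityˡ t ⟨
          1# * t       ≈⟨ *-congʳ ti≈1 ⟨
          t * i * t    ≈⟨ solve 2 (λ t i → t :* i :* t := i :* (t :* t)) refl t i ⟩
          i * (t * t)  ≤⟨ *-monoˡ-≤ (<⇒≤ 0<i) t²≤ ⟩
          i * Σdw      ≈⟨ ∑-* i (λ u → d u * w u) ⟨
          ∑ ℝ x        ∎

      Approximant : Carrier → Matrix ℝ W → Carrier → Matrix ℝ W → Set
      Approximant t Z∞ ε Z = (ThetaFeasible ℝ H Z × t ≤ ⟨_,_⟩ ℝ (J ℝ) Z + ε) ×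
        (∀ ((u , v) : W × W) → Near ε (Z u v) (Z∞ u v))

      -- For each fixed test vector the form is linear in the matrix, like the trace and the
      -- objective, so every condition is one on finite sums of scaled entries and passes to the
      -- limit.
      limit-feasible : ∀ {t Z∞} → Approximable (Approximant t Z∞) →
                       ThetaFeasible ℝ H Z∞ × t ≤ ⟨_,_⟩ ℝ (J ℝ) Z∞
      limit-feasible {t} {Z∞} approx = (psd , trace , vanish) , optimal
        where
        open Limits (Approximant t Z∞)

        entry : ∀ u v → Lim (λ Z → Z u v) (Z∞ u v)
        entry u v = Lim-near λ (_ , n) → n (u , v)

        quadratic : ∀ z → Lim (λ Z → form Z z z) (form Z∞ z z)
        quadratic z = Lim-∑ λ u → Lim-∑ λ v → Lim-cong
          (λ Z → solve 3 (λ a b c → a :* c :* b := a :* b :* c) refl (z u) (Z u v) (z v))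
          (solve 3 (λ a b c → a :* c :* b := a :* b :* c) refl (z u) (Z∞ u v) (z v))
          (Lim-scale (z u * z v) (entry u v))

        psd : PSD ℝ Z∞
        psd = (λ u v → lim-≈ approx (entry u v) (entry v u) λ (((psd , _) , _) , _) → proj₁ psd u v) ,
          λ z → lim-≤ approx (Lim-const 0#) (quadratic z) λ (((psd , _) , _) , _) → proj₂ psd z

        trace : tr ℝ Z∞ ≈ 1#
        trace = lim-≈ approx (Lim-∑ λ v → entry v v) (Lim-const 1#) λ (((_ , tr≈1 , _) , _) , _) → tr≈1

        vanish : ∀ {u v} → Adj u v → Z∞ u v ≈ 0#
        vanish {u} {v} e = lim-≈ approx (entry u v) (Lim-const 0#) λ (((_ , _ , vanish) , _) , _) → vanish e

        optimal : t ≤ ⟨_,_⟩ ℝ (J ℝ) Z∞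
        optimal = lim-mono approx (Lim-const t) (Lim-∑ λ u → Lim-∑ λ v → Lim-scale 1# (entry u v)) λ _ ((_ , h) , _) → h

      ϑ-attained : W → ∃[ t ] ϑ ℝ H t
      ϑ-attained w = t , (proj₁ limit , proj₁ (proj₂ limit) , antisym (upper (proj₁ (proj₂ limit)) refl) (proj₂ (proj₂ limit))) ,
                     λ Z f → upper f refl
        where
        Value : Carrier → Set
        Value m = ∃[ Z ] ThetaFeasible ℝ H Z × ⟨_,_⟩ ℝ (J ℝ) Z ≈ m
        least = supremum Value (1# , outer (δ w) , δ-feasible w , ⟨J,outer-δ⟩ w)
          (_ , λ (_ , f , eq) → ≤-trans (≤-reflexive (sym eq)) (⟨J,⟩-bounded f))
        t = proj₁ least
        upper : ∀ {Z m} → ThetaFeasible ℝ H Z → ⟨_,_⟩ ℝ (J ℝ) Z ≈ m → m ≤ t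
        upper f eq = proj₁ (proj₂ least) (_ , f , eq)

        NearlyOptimal : Carrier → Matrix ℝ W → Set
        NearlyOptimal ε Z = ThetaFeasible ℝ H Z × t ≤ ⟨_,_⟩ ℝ (J ℝ) Z + ε

        approx : Approximable NearlyOptimal
        -- Were no feasible matrix within `ε` of the supremum, `t - ε` would be an upper bound of
        -- the values.
        approx {ε} 0<ε none = x<x+ε {t + - ε} 0<ε (begin
          t + - ε + ε ≈⟨ solve 2 (λ t e → t :+ :- e :+ e := t) refl t ε ⟩
          t           ≤⟨ proj₂ (proj₂ least) (t + - ε) (λ (Z , f , eq) → ≤-stable λ far → none (Z , f , (begin
            t                          ≈⟨ solve 2 (λ t e → t := t :+ :- e :+ e) refl t ε ⟩
            t + - ε + ε                ≤⟨ +-mono-≤ (<⇒≤ far) ≤-refl ⟩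
            _ + ε                      ≈⟨ +-congʳ eq ⟨
            ⟨_,_⟩ ℝ (J ℝ) Z + ε        ∎))) ⟩
          t + - ε     ∎)

        limit : ∃[ Z ] ThetaFeasible ℝ H Z × t ≤ ⟨_,_⟩ ℝ (J ℝ) Z
        limit = let a , near = cluster-family NearlyOptimal (λ ε≤δ (f , h) → f , ≤-trans h (+-monoʳ-≤ _ ε≤δ)) approx
                      (λ (u , v) Z → Z u v) (- 1#) 1# (λ (u , v) (f , _) → entry-bounded f u v)
                in (λ u v → a (u , v)) , limit-feasible near

      -- The feasible matrix of value 1 makes t positive, so the optimiser can be rescaled into TH.
      -- Points of TH with sum at most 0 cannot be normalised, but lie below t anyway.
      ϑ⇒max-TH : W → ∀ {t} → ϑ ℝ H t → IsMaximum ℝ (∑ ℝ) (TH ℝ H) t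
      ϑ⇒max-TH w {t} ((Z , f , Z≈t) , max) =
        let x , th , t≤∑x = theta⇒TH f (<-≤-trans 0<t (≤-reflexive (sym Z≈t)))
        in (x , th , antisym (upper x th) (≤-trans (≤-reflexive (sym Z≈t)) t≤∑x)) , upper
        where
        0<t : 0# < t
        0<t = <-≤-trans 0<1 (≤-trans (≤-reflexive (sym (⟨J,outer-δ⟩ w))) (max _ (δ-feasible w)))
        upper : ∀ x → TH ℝ H x → ∑ ℝ x ≤ t
        upper x th with ∑ ℝ x ≤? 0#
        ... | yes s≤0 = ≤-trans s≤0 (<⇒≤ 0<t)
        ... | no  0<s = let Z , f , s≤ = TH⇒theta th 0<s in ≤-trans s≤ (max Z f)

-- The conflict graph of -G as a Cartesian product.

module _ {V : Set} {{finite : Finite V}} (G : SimpleGraph V) where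

  -- A positive loop sends s to -s at the same vertex, the K₂ direction; a negative edge sends s to
  -- -(-s) = s, the G direction inside one layer.
  conflict⇔K₂□ : ∀ x y → SimpleGraph.Adj (conflictGraph (neg G)) x y
                       ⇔ SimpleGraph.Adj (K₂ □ G) (swap x) (swap y)
  conflict⇔K₂□ (u , s) (v , r) = mk⇔ to from
    where
    to : SimpleGraph.Adj (conflictGraph (neg G)) (u , s) (v , r) →
         SimpleGraph.Adj (K₂ □ G) (s , u) (r , v)
    to (inj₁ u≡v , ≡.refl) = inj₂ ((λ s≡-s → Sign.s≢opposite[s] s s≡-s) , u≡v)
    to (inj₂ e   , ≡.refl) = inj₁ (≡.sym (Sign.opposite-involutive _) , e)
    from : SimpleGraph.Adj (K₂ □ G) (s , u) (r , v) →
           SimpleGraph.Adj (conflictGraph (neg G)) (u , s) (v , r)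
    from (inj₁ (≡.refl , e)) = inj₂ e , ≡.sym (Sign.opposite-involutive _)
    from (inj₂ (s≢r , u≡v))  = inj₁ u≡v , other s≢r
      where
      other : ∀ {s r} → s ≢ r → r ≡ opposite s
      other {Sign.+} {Sign.+} s≢r = ⊥-elim (s≢r ≡.refl)
      other {Sign.+} {Sign.-} s≢r = ≡.refl
      other {Sign.-} {Sign.+} s≢r = ≡.refl
      other {Sign.-} {Sign.-} s≢r = ⊥-elim (s≢r ≡.refl)

nonempty? : {V : Set} {{finite : Finite V}} (K : Subset V) → Dec (∃[ v ] v ∈ K)
nonempty? {{finite}} K with Fin.any? (λ i → T? (K (Finite.element finite i)))
... | yes (i , k) = yes (_ , k)
... | no  ¬k      = no λ (v , k) → ¬k (_ , ≡.subst (_∈ K) (≡.sym (Inverse.strictlyInverseʳ (Finite.enum finite) v)) k)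

-- Transport along isomorphisms, and the projected bodies.

module Bodies (ℝ : CompleteOrderedField) where
  open OrderedField ℝ
  open Sums ℝ
  open Forms ℝ
  open Theta ℝ

  module _ {W W′ : Set} {{finW : Finite W}} {{finW′ : Finite W′}} where

    ∑∑-reindex : (π : W′ ↔ W) (g : W → W → Carrier) →
      ∑ ℝ (λ a → ∑ ℝ (λ b → g (Inverse.to π a) (Inverse.to π b))) ≈ ∑ ℝ (λ u → ∑ ℝ (g u))
    ∑∑-reindex π g = trans (∑-cong λ a → ∑-reindex π (g (Inverse.to π a)))
                           (∑-reindex π (λ u → ∑ ℝ (g u)))

    module _ (H : SimpleGraph W) (H′ : SimpleGraph W′) (π : W′ ↔ W)
             (hom : ∀ {a b} → SimpleGraph.Adj H′ a b → SimpleGraph.Adj H (Inverse.to π a) (Inverse.to π b)) where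

      open Inverse π using (to; from; strictlyInverseʳ)

      pullback : Matrix ℝ W → Matrix ℝ W′
      pullback Z a b = Z (to a) (to b)

      pullback-feasible : ∀ {Z} → ThetaFeasible ℝ H Z → ThetaFeasible ℝ H′ (pullback Z)
      pullback-feasible {Z} ((sym-Z , Z≥0) , tr≈1 , vanish) =
        ((λ a b → sym-Z (to a) (to b)) , λ z → ≤-trans (Z≥0 (z ∘ from)) (≤-reflexive (sym (begin-equality
          form (pullback Z) z z
            ≈⟨ ∑-cong (λ a → ∑-cong λ b → *-cong (*-congʳ {pullback Z a b} (back z a)) (back z b)) ⟩
          ∑ ℝ (λ a → ∑ ℝ (λ b → z (from (to a)) * Z (to a) (to b) * z (from (to b))))
            ≈⟨ ∑∑-reindex π (λ u v → z (from u) * Z u v * z (from v)) ⟩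
          form Z (z ∘ from) (z ∘ from) ∎)))) ,
        trans (∑-reindex π (λ u → Z u u)) tr≈1 ,
        λ e → vanish (hom e)
        where
        back : ∀ z a → z a ≈ z (from (to a))
        back z a = reflexive (≡.cong z (≡.sym (strictlyInverseʳ a)))

      ⟨J,pullback⟩ : ∀ Z → ⟨_,_⟩ ℝ (J ℝ) (pullback Z) ≈ ⟨_,_⟩ ℝ (J ℝ) Z
      ⟨J,pullback⟩ Z = ∑∑-reindex π (λ u v → 1# * Z u v)

  -- Pulling a feasible matrix back along an edge-preserving bijection keeps its value. One
  -- direction of the isomorphism transports the optimiser, the other the upper bound.
  ϑ-resp-≅ : {W W′ : Set} {{finW : Finite W}} {{finW′ : Finite W′}}
             (H : SimpleGraph W) (H′ : SimpleGraph W′) (π : W ↔ W′) →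
             (∀ a b → SimpleGraph.Adj H a b ⇔ SimpleGraph.Adj H′ (Inverse.to π a) (Inverse.to π b)) →
             ∀ {t} → ϑ ℝ H t → ϑ ℝ H′ t
  ϑ-resp-≅ H H′ π iso ((Z , f , Z≈t) , max) =
    (_ , pullback-feasible H H′ (↔-sym π) hom′ f , trans (⟨J,pullback⟩ H H′ (↔-sym π) hom′ Z) Z≈t) ,
    λ Z′ f′ → ≤-trans (≤-reflexive (sym (⟨J,pullback⟩ H′ H π hom Z′))) (max _ (pullback-feasible H′ H π hom f′))
    where
    open Inverse π using (to; from; strictlyInverseˡ)
    hom : ∀ {a b} → SimpleGraph.Adj H a b → SimpleGraph.Adj H′ (to a) (to b)
    hom {a} {b} = Equivalence.to (iso a b)
    hom′ : ∀ {a b} → SimpleGraph.Adj H′ a b → SimpleGraph.Adj H (from a) (from b)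
    hom′ {a} {b} e = Equivalence.from (iso (from a) (from b))
      (≡.subst₂ (SimpleGraph.Adj H′) (≡.sym (strictlyInverseˡ a)) (≡.sym (strictlyInverseˡ b)) e)

  module _ {V : Set} {{finite : Finite V}} where

    ∑-layers : (f : V × Sign → Carrier) →
               ∑ ℝ f ≈ ∑ ℝ (λ v → f (v , Sign.+)) + ∑ ℝ (λ v → f (v , Sign.-))
    ∑-layers f = trans (∑-× f) (trans (∑-cong λ v → ∑-Sign (λ s → f (v , s)))
      (∑-+ (λ v → f (v , Sign.+)) (λ v → f (v , Sign.-))))

    ∑-p : (y : V × Sign → Carrier) → ∑ ℝ (p ℝ y) ≈ ∑ ℝ y
    ∑-p y = trans (∑-+ (λ v → y (v , Sign.+)) (λ v → y (v , Sign.-))) (sym (∑-layers y))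

    max-TH⇒max-BTH : (Γ : SignedGraph V) → ∀ {t} →
      IsMaximum ℝ (∑ ℝ) (TH ℝ (conflictGraph Γ)) t → IsMaximum ℝ (∑ ℝ) (BTH ℝ Γ) t
    max-TH⇒max-BTH Γ ((y , th , y≈t) , max) =
      (p ℝ y , (y , th , λ v → refl) , trans (∑-p y) y≈t) ,
      λ x (y , th , x≈py) → ≤-trans (≤-reflexive (trans (∑-cong x≈py) (∑-p y))) (max y th)

    restrict-∈ : ∀ (K : Subset V) (f : Vector ℝ V) {v} → v ∈ K → (if K v then f v else 0#) ≈ f v
    restrict-∈ K f {v} v∈K with K v
    ... | true = refl

    restrict-∉ : ∀ (K : Subset V) (f : Vector ℝ V) {v} → ¬ v ∈ K → (if K v then f v else 0#) ≈ 0#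
    restrict-∉ K f {v} v∉K with K v
    ... | true  = ⊥-elim (v∉K tt)
    ... | false = refl

    ∑[]-empty : ∀ K (f : Vector ℝ V) → ¬ (∃[ v ] v ∈ K) → ∑[_] ℝ K f ≈ 0#
    ∑[]-empty K f empty = trans (∑-cong λ v → restrict-∉ K f (λ v∈K → empty (v , v∈K))) (∑-0 {V = V})

    ∑[]-singleton : ∀ K (f : Vector ℝ V) {u} → u ∈ K → (∀ {v} → v ∈ K → v ≡ u) → ∑[_] ℝ K f ≈ f u
    ∑[]-singleton K f {u} u∈K unique = trans
      (∑-single (λ v → if K v then f v else 0#) u λ v v≢u → restrict-∉ K f (λ v∈K → v≢u (unique v∈K)))
      (restrict-∈ K f u∈K)

    ∑[]-+ : ∀ K (f g : Vector ℝ V) → ∑[_] ℝ K (λ v → f v + g v) ≈ ∑[_] ℝ K f + ∑[_] ℝ K g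
    ∑[]-+ K f g = trans (∑-cong split) (∑-+ (λ v → if K v then f v else 0#) (λ v → if K v then g v else 0#))
      where
      split : ∀ v → (if K v then f v + g v else 0#) ≈ (if K v then f v else 0#) + (if K v then g v else 0#)
      split v with K v
      ... | true  = refl
      ... | false = sym (+-identityˡ 0#)

    ∑[]-* : ∀ K c (f : Vector ℝ V) → ∑[_] ℝ K (λ v → c * f v) ≈ c * ∑[_] ℝ K f
    ∑[]-* K c f = trans (∑-cong pull) (∑-* c (λ v → if K v then f v else 0#))
      where
      pull : ∀ v → (if K v then c * f v else 0#) ≈ c * (if K v then f v else 0#)
      pull v with K v
      ... | true  = refl
      ... | false = sym (zeroʳ c)

    ∑[]-cong : ∀ K {f g : Vector ℝ V} → (∀ v → f v ≈ g v) → ∑[_] ℝ K f ≈ ∑[_] ℝ K g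
    ∑[]-cong K {f} {g} f≈g = ∑-cong pointwise
      where
      pointwise : ∀ v → (if K v then f v else 0#) ≈ (if K v then g v else 0#)
      pointwise v with K v
      ... | true  = f≈g v
      ... | false = refl

    module _ (G : SimpleGraph V) where
      private
        module G = SimpleGraph G
        C = conflictGraph (neg G)

      fibre : V → Subset (V × Sign)
      fibre v (w , _) = does (Finite._≟_ finite w v)

      ∈-fibre⁻ : ∀ {v w s} → (w , s) ∈ fibre v → w ≡ v
      ∈-fibre⁻ {v} {w} k = decidable-stable (Finite._≟_ finite w v) λ w≢v →
        ≡.subst T (dec-false (Finite._≟_ finite w v) w≢v) k

      ∈-fibre⁺ : ∀ {v s} → (v , s) ∈ fibre v
      ∈-fibre⁺ {v} rewrite dec-true (Finite._≟_ finite v v) ≡.refl = tt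

      fibre-clique : ∀ v → IsClique C (fibre v)
      fibre-clique v {u , s} {w , r} k l ≢ = Equivalence.from (conflict⇔K₂□ G (u , s) (w , r))
        (inj₂ ((λ s≡r → ≢ (≡.cong₂ _,_ u≡w s≡r)) , u≡w))
        where
        u≡w : u ≡ w
        u≡w = ≡.trans (∈-fibre⁻ {s = s} k) (≡.sym (∈-fibre⁻ {s = r} l))

      -- With the sign test first, membership computes to `K v` on the chosen layer and to `false`
      -- on the other, so sums over it reduce.
      layer : Sign → Subset V → Subset (V × Sign)
      layer s K (v , r) = does (s Sign.≟ r) ∧ K v

      ∈-layer⁻ : ∀ {s r K v} → (v , r) ∈ layer s K → s ≡ r × v ∈ K
      ∈-layer⁻ {Sign.+} {Sign.+} k = ≡.refl , k
      ∈-layer⁻ {Sign.-} {Sign.-} k = ≡.refl , k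

      layer-clique : ∀ s {K} → IsClique G K → IsClique C (layer s K)
      layer-clique s {K} clique {u , r} {v , r′} k l ≢
        with ∈-layer⁻ {s} {r} {K} {u} k | ∈-layer⁻ {s} {r′} {K} {v} l
      ... | ≡.refl , u∈K | ≡.refl , v∈K = Equivalence.from (conflict⇔K₂□ G (u , s) (v , s))
        (inj₁ (≡.refl , clique u∈K v∈K λ u≡v → ≢ (≡.cong (_, s) u≡v)))

      section-clique : ∀ {K} → IsClique C K → ∀ s → IsClique G (λ v → K (v , s))
      section-clique clique s {u} {v} u∈K v∈K u≢v
        with Equivalence.to (conflict⇔K₂□ G (u , s) (v , s)) (clique u∈K v∈K (u≢v ∘ ≡.cong proj₁))
      ... | inj₁ (_ , e)     = e
      ... | inj₂ (s≢s , _)   = ⊥-elim (s≢s ≡.refl)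

      opposite-in-clique : ∀ {K} → IsClique C K → ∀ {u v} → (u , Sign.+) ∈ K → (v , Sign.-) ∈ K → u ≡ v
      opposite-in-clique clique {u} {v} u∈K v∈K
        with Equivalence.to (conflict⇔K₂□ G (u , Sign.+) (v , Sign.-)) (clique u∈K v∈K (λ ()))
      ... | inj₂ (_ , u≡v) = u≡v

      -- The fibre over a vertex is a clique, whence x_v ≤ 1; a clique of G lifts to one clique in
      -- each layer, whence 1 + 1.
      BQSTAB⇒CliqueBody : ∀ {x} → BQSTAB ℝ (neg G) x → CliqueBody ℝ G x
      BQSTAB⇒CliqueBody {x} (y , (0≤y , cliques) , x≈py) =
        (λ v → ≤-trans (+-nonneg (0≤y _) (0≤y _)) (≤-reflexive (sym (x≈py v))) , (begin
          x v                                   ≈⟨ x≈py v ⟩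
          y (v , Sign.+) + y (v , Sign.-)       ≈⟨ +-cong (on v Sign.+) (on v Sign.-) ⟨
          _ + _                                 ≈⟨ ∑-layers (λ q → if fibre v q then y q else 0#) ⟨
          ∑[_] ℝ (fibre v) y                    ≤⟨ cliques (fibre v) (fibre-clique v) ⟩
          1#                                    ∎)) ,
        λ K clique → begin
          ∑[_] ℝ K x                                          ≈⟨ ∑[]-cong K x≈py ⟩
          ∑[_] ℝ K (p ℝ y)                                    ≈⟨ ∑[]-+ K (λ v → y (v , Sign.+)) (λ v → y (v , Sign.-)) ⟩
          ∑[_] ℝ K (λ v → y (v , Sign.+)) + ∑[_] ℝ K (λ v → y (v , Sign.-)) ≤⟨ +-mono-≤
            (≤-trans (≤-reflexive (layer⁺ K)) (cliques (layer Sign.+ K) (layer-clique Sign.+ clique)))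
            (≤-trans (≤-reflexive (layer⁻ K)) (cliques (layer Sign.- K) (layer-clique Sign.- clique))) ⟩
          1# + 1#                                             ∎
        where
        on : ∀ v s → ∑[_] ℝ (λ w → fibre v (w , s)) (λ w → y (w , s)) ≈ y (v , s)
        on v s = ∑[]-singleton (λ w → fibre v (w , s)) (λ w → y (w , s)) (∈-fibre⁺ {v} {s}) (∈-fibre⁻ {s = s})
        layer⁺ : ∀ K → ∑[_] ℝ K (λ v → y (v , Sign.+)) ≈ ∑[_] ℝ (layer Sign.+ K) y
        layer⁺ K = sym (trans (∑-layers (λ q → if layer Sign.+ K q then y q else 0#))
                              (trans (+-congˡ (∑-0 {V = V})) (+-identityʳ _)))
        layer⁻ : ∀ K → ∑[_] ℝ K (λ v → y (v , Sign.-)) ≈ ∑[_] ℝ (layer Sign.- K) y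
        layer⁻ K = sym (trans (∑-layers (λ q → if layer Sign.- K q then y q else 0#))
                              (trans (+-congʳ (∑-0 {V = V})) (+-identityˡ _)))

      CliqueBody⇒BQSTAB : ∀ {x} → CliqueBody ℝ G x → BQSTAB ℝ (neg G) x
      CliqueBody⇒BQSTAB {x} (box , cliques) =
        (λ (v , _) → h * x v) , ((λ (v , _) → *-nonneg 0≤h (proj₁ (box v))) , bound) ,
        λ v → sym (halves (x v))
        where
        2-inverse = recip {1# + 1#} (nonneg+1-pos 0≤1)
        h = proj₁ 2-inverse
        2h≈1 : (1# + 1#) * h ≈ 1#
        2h≈1 = proj₁ (proj₂ 2-inverse)
        0≤h : 0# ≤ h
        0≤h = <⇒≤ (proj₂ (proj₂ 2-inverse))
        halves : ∀ a → h * a + h * a ≈ a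
        halves a = begin-equality
          h * a + h * a        ≈⟨ solve 2 (λ h a → h :* a :+ h :* a := (con (+ 1) :+ con (+ 1)) :* h :* a) refl h a ⟩
          (1# + 1#) * h * a    ≈⟨ *-congʳ 2h≈1 ⟩
          1# * a               ≈⟨ *-identityˡ a ⟩
          a                    ∎
        hx : Vector ℝ V
        hx v = h * x v
        bound : ∀ K → IsClique C K → ∑[_] ℝ K (λ (v , _) → hx v) ≤ 1#
        bound K clique = begin
          ∑[_] ℝ K (λ (v , _) → hx v)  ≈⟨ ∑-layers (λ (v , s) → if K (v , s) then hx v else 0#) ⟩
          ∑[_] ℝ (K⁺) hx + ∑[_] ℝ (K⁻) hx ≤⟨ sections (nonempty? K⁺) (nonempty? K⁻) ⟩
          1#                           ∎
          where
          K⁺ K⁻ : Subset V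
          K⁺ v = K (v , Sign.+)
          K⁻ v = K (v , Sign.-)
          section-bound : ∀ s → ∑[_] ℝ (λ v → K (v , s)) hx ≤ 1#
          section-bound s = begin
            ∑[_] ℝ (λ v → K (v , s)) hx      ≈⟨ ∑[]-* (λ v → K (v , s)) h x ⟩
            h * ∑[_] ℝ (λ v → K (v , s)) x   ≤⟨ *-monoˡ-≤ 0≤h (cliques (λ v → K (v , s)) (section-clique clique s)) ⟩
            h * (1# + 1#)                    ≈⟨ trans (*-comm _ _) 2h≈1 ⟩
            1#                               ∎
          sections : Dec (∃[ v ] v ∈ K⁺) → Dec (∃[ v ] v ∈ K⁻) → ∑[_] ℝ K⁺ hx + ∑[_] ℝ K⁻ hx ≤ 1#
          sections (no empty) _ = begin
            ∑[_] ℝ K⁺ hx + ∑[_] ℝ K⁻ hx ≈⟨ +-congʳ (∑[]-empty K⁺ hx empty) ⟩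
            0# + ∑[_] ℝ K⁻ hx           ≈⟨ +-identityˡ _ ⟩
            ∑[_] ℝ K⁻ hx                ≤⟨ section-bound Sign.- ⟩
            1#                          ∎
          sections (yes _) (no empty) = begin
            ∑[_] ℝ K⁺ hx + ∑[_] ℝ K⁻ hx ≈⟨ +-congˡ (∑[]-empty K⁻ hx empty) ⟩
            ∑[_] ℝ K⁺ hx + 0#           ≈⟨ +-identityʳ _ ⟩
            ∑[_] ℝ K⁺ hx                ≤⟨ section-bound Sign.+ ⟩
            1#                          ∎
          -- Each member of one section equals each member of the other, so both are the singleton
          -- of `u` and the two halves add up to `x u`.
          sections (yes (u , u∈K⁺)) (yes (v , v∈K⁻)) = begin
            ∑[_] ℝ K⁺ hx + ∑[_] ℝ K⁻ hx
              ≈⟨ +-cong (∑[]-singleton K⁺ hx u∈K⁺ λ w∈K⁺ → ≡.trans (opposite-in-clique clique w∈K⁺ v∈K⁻) (≡.sym u≡v))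
                        (∑[]-singleton K⁻ hx (≡.subst (_∈ K⁻) (≡.sym u≡v) v∈K⁻) λ w∈K⁻ → ≡.sym (opposite-in-clique clique u∈K⁺ w∈K⁻)) ⟩
            h * x u + h * x u  ≈⟨ halves (x u) ⟩
            x u                ≤⟨ proj₂ (box u) ⟩
            1#                 ∎
            where
            u≡v : u ≡ v
            u≡v = opposite-in-clique clique u∈K⁺ v∈K⁻

      -- The optimum of the conflict graph is found once and read twice: through TH as the maximum
      -- over BTH, through the isomorphism as the theta number of the product.
      max-BTH≈ϑ : V → ∃[ t ] IsMaximum ℝ (∑ ℝ) (BTH ℝ (neg G)) t × ϑ ℝ (K₂ □ G) t
      max-BTH≈ϑ v =
        let t , max = ϑ-attained C (v , Sign.+)
        in t , max-TH⇒max-BTH (neg G) (ϑ⇒max-TH C (v , Sign.+) max) ,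
               ϑ-resp-≅ C (K₂ □ G) (×-comm V Sign) (conflict⇔K₂□ G) max

proposition7p6 : (ℝ : CompleteOrderedField) {V : Set} {{finite : Finite V}} (G : SimpleGraph V) →
    (BSTAB ℝ (neg G) ≐ BIP ℝ G)
    × (∀ x y → SimpleGraph.Adj (conflictGraph (neg G)) x y
    ⇔ SimpleGraph.Adj (K₂ □ G) (swap x) (swap y))
    × (V → ∃[ t ] IsMaximum ℝ (∑ ℝ) (BTH ℝ (neg G)) t × ϑ ℝ (K₂ □ G) t)
    × (BQSTAB ℝ (neg G) ≐ CliqueBody ℝ G)
proposition7p6 ℝ G =
  BSTAB≐BIP ℝ G , conflict⇔K₂□ G , max-BTH≈ϑ G , (BQSTAB⇒CliqueBody G , CliqueBody⇒BQSTAB G)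
  where open Bodies ℝ
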